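{- The exponential growth rate of the number of meanders with shallow top of order $n$, that is, $$\limsup_{n\to\infty}\sqrt[n]{\left|\overline{\mathfrak{M}_1}(n)\right|},$$ is roughly $5.22$.
   Context: For a positive integer $n$, a partition $\pi$ of $\{1,\ldots,n\}$ is non-crossing if there are no two distinct blocks $V,W$ of $\pi$ and numbers $a<b<c<d$ in $\{1,\ldots,n\}$ with $a,c\in V$ and $b,d\in W$. $\mathrm{NC}(n)$ is the set of non-crossing partitions of $\{1,\ldots,n\}$, partially ordered by $\pi\le\rho$ iff every block of $\pi$ is contained in a block of $\rho$. The Hasse diagram $\mathcal{H}_n$ is the undirected graph with vertex set $\mathrm{NC}(n)$ in which $\pi_1,\pi_2$ are joined by an edge iff one of them covers the other; $d_H$ is the graph distance in $\mathcal{H}_n$. $\mathrm{Int}(n)\subseteq\mathrm{NC}(n)$ is the set of interval partitions: those in which every block has the form $\{i\in\mathbb{N}\mid p\le i\le q\}$ for some $p\le q$ in $\{1,\ldots,n\}$. The set of meanders with shallow top of order $n$ is (identified with) $\overline{\mathfrak{M}_1}(n)=\{(\pi,\rho)\in\mathrm{Int}(n)\times\mathrm{NC}(n)\mid d_H(\pi,\rho)=n-1\}$. The exponential growth rate of the number of these meanders is by definition the limit superior of the $n$-th roots of $\left|\overline{\mathfrak{M}_1}(n)\right|$. -}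

module Defs where

open import Level using (0ℓ)
open import Algebra.Bundles using (RawSemiring)
import Algebra.Definitions.RawSemiring as RawSemiringDefinitions
open import Data.Fin.Base as Fin using (Fin)
open import Data.Fin.Subset using (Subset; _∈_; _⊆_)
open import Data.Fin.Subset.Properties using (⊆-refl; ⊆-trans; ⊆-antisym)
open import Data.Integer.Base using (+_)
open import Data.Nat.Base as ℕ using (ℕ; zero; suc; _∸_; NonZero)
open import Data.Product.Base using (Σ-syntax; ∃-syntax; _×_; _,_; proj₁; proj₂)
open import Data.Product.Relation.Binary.Pointwise.NonDependent using (×-setoid)
open import Data.Rational.Base as ℚ using (ℚ; _/_; 0ℚ; _<_; _+_; _-_)
open import Data.Sum.Base using (_⊎_)
open import Function.Bundles using (Inverse; _⇔_)
open import Relation.Binary.Bundles using (Setoid; Poset)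
import Relation.Binary.Construct.NonStrictToStrict as ToStrict
import Relation.Binary.Construct.On as On
open import Relation.Binary.PropositionalEquality
  using (_≡_; _≢_; refl; sym; trans; subst; setoid)
open import Relation.Nullary.Negation using (¬_)

open RawSemiringDefinitions ℚ.+-*-rawSemiring using (_^_)

------------------------------------------------------------------------
-- Non-crossing partitions.  The ground set {1,…,n} is represented by Fin n.

-- A partition is given by the function sending each point to the block
-- containing it.  The two laws say exactly that the values of this function
-- are non-empty, pairwise disjoint and cover the ground set.

record Partition (n : ℕ) : Set where
  field
    block      : Fin n → Subset n
    block-self : ∀ i → i ∈ block i
    block-same : ∀ {i j} → j ∈ block i → block j ≡ block i

open Partition public

IsBlock : ∀ {n} → Partition n → Subset n → Set
IsBlock π V = ∃[ i ] block π i ≡ V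

NonCrossing : ∀ {n} → Partition n → Set
NonCrossing {n} π =
  ∀ (V W : Subset n) → IsBlock π V → IsBlock π W → V ≢ W →
  ¬ (Σ[ a ∈ Fin n ] Σ[ b ∈ Fin n ] Σ[ c ∈ Fin n ] Σ[ d ∈ Fin n ]
       (a Fin.< b × b Fin.< c × c Fin.< d) ×
       (a ∈ V × c ∈ V) × (b ∈ W × d ∈ W))

NC : ℕ → Set
NC n = Σ[ π ∈ Partition n ] NonCrossing π

-- Two elements of NC n are equal when they have the same blocks; the proof
-- components and the intensional identity of the functions are disregarded.

infix 4 _≈_ _≤_

_≈_ : ∀ {n} → NC n → NC n → Set
(π , _) ≈ (ρ , _) = ∀ i → block π i ≡ block ρ i

_≤_ : ∀ {n} → NC n → NC n → Set
(π , _) ≤ (ρ , _) = ∀ V → IsBlock π V → ∃[ W ] IsBlock ρ W × V ⊆ W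

≤⇒block-⊆ : ∀ {n} (π ρ : NC n) → π ≤ ρ →
            ∀ i → block (proj₁ π) i ⊆ block (proj₁ ρ) i
≤⇒block-⊆ (π , _) (ρ , _) π≤ρ i with π≤ρ (block π i) (i , refl)
... | _ , (k , refl) , V⊆W =
  subst (block π i ⊆_) (sym (block-same ρ (V⊆W (block-self π i)))) V⊆W

NC-poset : ℕ → Poset 0ℓ 0ℓ 0ℓ
NC-poset n = record
  { Carrier        = NC n
  ; _≈_            = _≈_
  ; _≤_            = _≤_
  ; isPartialOrder = record
    { isPreorder = record
      { isEquivalence = record
        { refl  = λ i → refl
        ; sym   = λ p i → sym (p i)
        ; trans = λ p q i → trans (p i) (q i)
        }
      ; reflexive = λ { p V (i , refl) → _ , (i , sym (p i)) , ⊆-refl }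
      ; trans     = λ p q V V∈π →
          let W , W∈ρ , V⊆W = p V V∈π
              X , X∈σ , W⊆X = q W W∈ρ
          in  X , X∈σ , ⊆-trans V⊆W W⊆X
      }
    ; antisym = λ {π} {ρ} p q i →
        ⊆-antisym (≤⇒block-⊆ π ρ p i) (≤⇒block-⊆ ρ π q i)
    }
  }

NC-setoid : ℕ → Setoid 0ℓ 0ℓ
NC-setoid n = Poset.Eq.setoid (NC-poset n)

------------------------------------------------------------------------
-- The Hasse diagram and its graph distance

module _ {n : ℕ} where

  open ToStrict (_≈_ {n}) _≤_ public using () renaming (_<_ to _⊏_)

  _⋖_ : NC n → NC n → Set
  π ⋖ ρ = π ⊏ ρ × (∀ σ → ¬ (π ⊏ σ × σ ⊏ ρ))

  Adjacent : NC n → NC n → Set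
  Adjacent π ρ = π ⋖ ρ ⊎ ρ ⋖ π

  data Walk : ℕ → NC n → NC n → Set where
    nil  : ∀ {π ρ} → π ≈ ρ → Walk zero π ρ
    cons : ∀ {k π σ ρ} → Adjacent π σ → Walk k σ ρ → Walk (suc k) π ρ

  d-H[_,_]≡_ : NC n → NC n → ℕ → Set
  d-H[ π , ρ ]≡ d = Walk d π ρ × (∀ k → Walk k π ρ → d ℕ.≤ k)

------------------------------------------------------------------------
-- Meanders with shallow top

IsInterval : ∀ {n} → NC n → Set
IsInterval {n} (π , _) =
  ∀ V → IsBlock π V →
  Σ[ p ∈ Fin n ] Σ[ q ∈ Fin n ]
    p Fin.≤ q × (∀ i → i ∈ V ⇔ (p Fin.≤ i × i Fin.≤ q))

ShallowTopMeander : ℕ → Set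
ShallowTopMeander n =
  Σ[ (π , ρ) ∈ NC n × NC n ] IsInterval π × d-H[ π , ρ ]≡ (n ∸ 1)

M̄₁ : ℕ → Setoid 0ℓ 0ℓ
M̄₁ n = On.setoid {B = ShallowTopMeander n} (×-setoid (NC-setoid n) (NC-setoid n)) proj₁

HasCardinality : Setoid 0ℓ 0ℓ → ℕ → Set
HasCardinality S k = Inverse S (setoid (Fin k))

------------------------------------------------------------------------
-- Extended real numbers as pairs of cuts, n-th roots and limits superior

-- The extended real x is represented by its lower cut {q ∈ ℚ | q < x} and
-- its upper cut {q ∈ ℚ | x < q}.  Locatedness is not part of the data, so
-- that the limit superior of an arbitrary sequence can be formed.

record Cut : Set₁ where
  field
    lower : ℚ → Set
    upper : ℚ → Set

open Cut public

infix 4 _<ᴸ_ _<ᵁ_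

_<ᴸ_ : ℚ → Cut → Set
q <ᴸ x = lower x q

_<ᵁ_ : Cut → ℚ → Set
x <ᵁ q = upper x q

fromℕ : ℕ → ℚ
fromℕ a = + a / 1

-- The non-negative real n-th root of a.

root : (n : ℕ) .{{_ : NonZero n}} → ℕ → Cut
root n a = record
  { lower = λ q → q < 0ℚ ⊎ q ^ n < fromℕ a
  ; upper = λ q → 0ℚ < q × fromℕ a < q ^ n
  }

-- q < limsup x  iff  some r > q satisfies r < x k for arbitrarily large k;
-- limsup x < q  iff  some r < q satisfies x k < r for all large k.

limsup : (ℕ → Cut) → Cut
limsup x = record
  { lower = λ q → ∃[ r ] q < r × (∀ N → ∃[ k ] N ℕ.≤ k × r <ᴸ x k)
  ; upper = λ q → ∃[ r ] r < q × (∃[ N ] ∀ k → N ℕ.≤ k → x k <ᵁ r)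
  }

-- The limit superior of the n-th roots of a n over the positive integers
-- n = suc k.

growthRate : (ℕ → ℕ) → Cut
growthRate a = limsup (λ k → root (suc k) (a (suc k)))

-- ∣ x - q ∣ < ε

∣_-_∣<_ : Cut → ℚ → ℚ → Set
∣ x - q ∣< ε = (q - ε) <ᴸ x × x <ᵁ (q + ε)

{-# OPTIONS --safe #-}
module Submission where

-- For an interval partition π and a non-crossing ρ, the walks through the top,
-- through the bottom and through two-block partitions show that d-H(π , ρ) = n − 1
-- forces |π| + |ρ| = n + 1 and π ∨ ρ = 1: the bipartite graph whose vertices are
-- the blocks of π and ρ and whose edges are the points is a tree.  Conversely a walk
-- with u steps up reaches only a ρ with |π ∨ ρ| ≥ |π| − u, so for a tree every walk
-- has length at least (|π| − 1) + (|ρ| − 1) = n − 1.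
--
-- Reading the points from left to right with a stack of the open blocks of ρ, the
-- tree condition is checked by a pushdown automaton, so that the meanders are the
-- words it accepts.  Their generating function F satisfies
-- F = x (1 + F)(1 + F + F²) = x (1 + 2F + 2F² + F³), which makes a(n) a number of
-- lattice walks with steps −1, 0, 1, 2 of multiplicities 1, 2, 2, 1.  The growth rate
-- is the minimum 5.2192… of (1 + 2F + 2F² + F³)/F over F > 0: an upper bound comes
-- from evaluating at F = 4/7, a lower bound from the walks of bounded height, for
-- which an approximate eigenvector is computed.

open import Defs renaming (_≤_ to _≼_)
open import Axiom.UniquenessOfIdentityProofs.WithK using (uip)
import Algebra.Definitions.RawSemiring as RawSemiringDefinitions
open import Data.Bool.Base using (Bool; true; false; if_then_else_; _∧_; not)
open import Data.Bool.Properties using () renaming (_≟_ to _≟ᵇ_)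
open import Data.Fin.Base as Fin using (Fin; zero; suc; toℕ; fromℕ<; punchIn; punchOut)
import Data.Fin.Properties as Fin
open import Data.Fin.Subset using (Subset; _∈_)
open import Data.Empty using (⊥; ⊥-elim)
open import Data.Integer.Base using (+_; +<+)
import Data.Integer.Properties as ℤ
open import Data.List.Base using (List; []; _∷_)
open import Data.List.Relation.Unary.Any using (Any; here; there)
open import Data.Nat.Base using (ℕ; NonZero; zero; suc; pred; _+_; _*_; _^_; _∸_; _⊓_; _≤_; _<_; z≤n; s≤s; s≤s⁻¹; >-nonZero; >-nonZero⁻¹)
open import Data.Nat.Properties
open import Data.Nat.Tactic.RingSolver using (solve-∀)
open import Data.Product.Base using (Σ; Σ-syntax; ∃-syntax; _×_; _,_; proj₁; proj₂)
import Data.Product.Properties as Product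
open import Data.Rational.Base as ℚ using (ℚ; _/_; 0ℚ)
import Data.Rational.Properties as ℚ
import Data.Rational.Unnormalised.Base as ℚᵘ
import Data.Rational.Unnormalised.Properties as ℚᵘ
open import Data.Sum.Base using (_⊎_; inj₁; inj₂; [_,_]′)
open import Data.Sum.Function.Propositional using (_⊎-↔_)
open import Data.Unit.Base using (⊤; tt)
open import Data.Vec.Base using (Vec; []; _∷_; tabulate)
import Data.Vec.Properties as Vec
open import Function.Base using (_∘_; id; it; case_of_)
open import Function.Bundles using (Inverse; _↔_; mk↔ₛ′; _⇔_; mk⇔; Equivalence)
open import Function.Properties.Inverse using (↔-sym; ↔-trans)
open import Level using (0ℓ)
open import Relation.Binary.Bundles using (Setoid; Poset)
open import Relation.Binary.Definitions using (DecidableEquality; tri<; tri≈; tri>)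
open import Relation.Binary.PropositionalEquality
open import Relation.Nullary.Decidable using (Dec; yes; no; does; ¬?; _×-dec_; _→-dec_; toWitness; decidable-stable; does-⇔; map′; dec-true; dec-false)
open import Relation.Nullary.Negation using (¬_; contradiction)

open RawSemiringDefinitions ℚ.+-*-rawSemiring using () renaming (_^_ to _^ℚ_)

-- The two halves of the tree condition are obtained by different means when a meander is encoded.
-- Connectedness is used in the form that no window [p , q) is saturated for both partitions:
-- non-crossing makes the component of a floating interval fill such a window, and cutting it off
-- would give a two-block partition above both. Acyclicity is not derived by inspecting a cycle: an
-- Euler formula kept along the run turns |π| + |ρ| ≥ n + 1 into the absence of cycles.
--
-- The join of two non-crossing partitions in the lattice of all partitions may cross, so joins are
-- avoided altogether. Walks act on labellings of the points, and π ∨ ρ = 1 says that a labelling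
-- constant on all blocks is constant.
--
-- The minimum over F is attained where 2F³ + 2F² = 1, near 4/7. The lower bound uses the ratio
-- 266/51 just below it: (1 + 2F + 2F² + F³)/F = 266/51 has no positive solution, so the
-- corresponding recurrence cannot stay positive, and the point where it stops being positive
-- supplies the bound on the height.

-- Exponential bounds for the lattice walk numbers

-- L n h counts the words of length n that first reach height 0 at their end,
-- from height h, with 1, 2, 2, 1 kinds of letters changing the height by
-- −1, 0, 1, 2.
L : ℕ → ℕ → ℕ
L zero    zero    = 1
L zero    (suc h) = 0
L (suc n) zero    = 0
L (suc n) (suc h) = L n h + 2 * L n (suc h) + 2 * L n (suc (suc h)) + L n (suc (suc (suc h)))

-- 1023/196 is the value of (1 + 2F + 2F² + F³)/F at F = 4/7, near its minimum.
L-upper : ∀ n h → L n h * (196 ^ n * 7 ^ h) ≤ 1023 ^ n * 4 ^ h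
L-upper zero    zero    = ≤-refl
L-upper zero    (suc h) = z≤n
L-upper (suc n) zero    = z≤n
-- The factor 7 · 7 brings all four terms to the denominator `7 ^ (3 + h)`. Then 7³ + 2 · 7² · 4 + 2
-- · 7 · 4² + 4³ = 1023 and 196 = 7² · 4.
L-upper (suc n) (suc h) = *-cancelˡ-≤ (7 * 7) (begin
  7 * 7 * (L (suc n) (suc h) * (196 * 196 ^ n * (7 * 7 ^ h)))
    ≡⟨ expand 7 196 (L n h) (L n (1 + h)) (L n (2 + h)) (L n (3 + h)) (196 ^ n) (7 ^ h) ⟩
  196 * (7 * 7 * 7 * (L n h * (196 ^ n * 7 ^ h))
    + 2 * 7 * 7 * (L n (1 + h) * (196 ^ n * (7 * 7 ^ h)))
    + 2 * 7 * (L n (2 + h) * (196 ^ n * (7 * (7 * 7 ^ h))))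
    + L n (3 + h) * (196 ^ n * (7 * (7 * (7 * 7 ^ h)))))
    ≤⟨ *-monoʳ-≤ 196 (+-mono-≤ (+-mono-≤ (+-mono-≤
        (*-monoʳ-≤ (7 * 7 * 7) (L-upper n h))
        (*-monoʳ-≤ (2 * 7 * 7) (L-upper n (1 + h))))
        (*-monoʳ-≤ (2 * 7) (L-upper n (2 + h))))
        (L-upper n (3 + h))) ⟩
  196 * (7 * 7 * 7 * (1023 ^ n * 4 ^ h)
    + 2 * 7 * 7 * (1023 ^ n * (4 * 4 ^ h))
    + 2 * 7 * (1023 ^ n * (4 * (4 * 4 ^ h)))
    + 1023 ^ n * (4 * (4 * (4 * 4 ^ h))))
    ≡⟨ collect 7 4 196 (1023 ^ n) (4 ^ h) ⟩
  196 * (7 * 7 * 7 + 2 * 7 * 7 * 4 + 2 * 7 * 4 * 4 + 4 * 4 * 4) * (1023 ^ n * 4 ^ h)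
    ≡⟨ distribute (7 * 7) 1023 4 (1023 ^ n) (4 ^ h) ⟩
  7 * 7 * (1023 * 1023 ^ n * (4 * 4 ^ h)) ∎)
  where
  open ≤-Reasoning
  expand : ∀ k w a b c d x y →
    k * k * ((a + 2 * b + 2 * c + d) * (w * x * (k * y))) ≡
    w * (k * k * k * (a * (x * y)) + 2 * k * k * (b * (x * (k * y)))
      + 2 * k * (c * (x * (k * (k * y)))) + d * (x * (k * (k * (k * y)))))
  expand = solve-∀
  collect : ∀ k v w x y →
    w * (k * k * k * (x * y) + 2 * k * k * (x * (v * y))
      + 2 * k * (x * (v * (v * y))) + x * (v * (v * (v * y)))) ≡
    w * (k * k * k + 2 * k * k * v + 2 * k * v * v + v * v * v) * (x * y)
  collect = solve-∀
  distribute : ∀ k r v x y → (k * r * v) * (x * y) ≡ k * (r * x * (v * y))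
  distribute = solve-∀

L-suc-≥ : ∀ n h → L n h ≤ L (suc n) (suc h) × L n (suc h) ≤ L (suc n) (suc h)
L-suc-≥ n h =
  ≤-trans (m≤m+n (L n h) (2 * L n (suc h))) rest ,
  ≤-trans (m≤n*m (L n (suc h)) 2) (≤-trans (m≤n+m (2 * L n (suc h)) (L n h)) rest)
  where
  rest : L n h + 2 * L n (suc h) ≤ L (suc n) (suc h)
  rest = ≤-trans (m≤m+n _ (2 * L n (suc (suc h)))) (m≤m+n _ (L n (suc (suc (suc h)))))

L-positive : ∀ n h → suc h ≤ n → 1 ≤ L n (suc h)
L-positive (suc zero)    zero    _       = ≤-refl
L-positive (suc (suc n)) zero    _       =
  ≤-trans (L-positive (suc n) zero (s≤s z≤n)) (proj₂ (L-suc-≥ (suc n) zero))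
L-positive (suc zero)    (suc h) (s≤s ())
L-positive (suc (suc n)) (suc h) (s≤s p) =
  ≤-trans (L-positive (suc n) h p) (proj₁ (L-suc-≥ (suc n) (suc h)))

-- The eigenvector equation (266/51) g(h) = g(h−1) + 2 g(h) + 2 g(h+1) + g(h+2),
-- solved downwards with g(h) = G k / 51 ^ k at distance k = depth − h from a maximal
-- height.  Truncated subtraction turns it into an inequality in the direction needed
-- for a lower bound as soon as G vanishes at height 0, whatever was cut off.
-- G₃ carries three consecutive values so that evaluation is linear.
G₃ : ℕ → ℕ × ℕ × ℕ
G₃ zero    = 0 , 0 , 1
G₃ (suc k) = next (G₃ k)
  where
  next : ℕ × ℕ × ℕ → ℕ × ℕ × ℕ
  next (a , b , c) = b , c , 266 * c ∸ (2 * 51 * c + 2 * 51 ^ 2 * b + 51 ^ 3 * a)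

G : ℕ → ℕ
G k = proj₁ (G₃ k)

G-step : ∀ k → 266 * G (2 + k) ≤
  2 * 51 * G (2 + k) + 2 * 51 ^ 2 * G (1 + k) + 51 ^ 3 * G k + G (3 + k)
G-step k = m≤n+m∸n (266 * G (2 + k)) (2 * 51 * G (2 + k) + 2 * 51 ^ 2 * G (1 + k) + 51 ^ 3 * G k)

G-bound : ∀ k → G k ≤ 266 ^ k
G-bound 0 = z≤n
G-bound 1 = z≤n
G-bound 2 = s≤s z≤n
G-bound (suc (suc (suc k))) = ≤-trans
  (m∸n≤m (266 * G (2 + k)) (2 * 51 * G (2 + k) + 2 * 51 ^ 2 * G (1 + k) + 51 ^ 3 * G k))
  (*-monoʳ-≤ 266 (G-bound (suc (suc k))))

module LowerBound (depth : ℕ) (G-vanishes : G depth ≡ 0) where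

  -- By `G-step` the vector g is a sub-eigenvector for 266/51, so each step of the walk gains this
  -- factor. The `depth` additional letters make `L` positive at every height from 1 to `depth` in
  -- the base case, where `266 ^ depth` dominates all entries of `G`. At k = 0 and k = 1, the top
  -- two heights, `G` is zero.
  L-lower : ∀ n h k → h + k ≡ depth →
    266 ^ n * G k ≤ 51 ^ n * 51 ^ k * 266 ^ depth * L (depth + n) h
  L-lower n       zero    k refl =
    ≤-trans (≤-reflexive (trans (cong (266 ^ n *_) G-vanishes) (*-zeroʳ (266 ^ n)))) z≤n
  L-lower zero    (suc h) k refl = begin
    1 * G k                                             ≡⟨ *-identityˡ (G k) ⟩
    G k                                                 ≤⟨ G-bound k ⟩
    266 ^ k                                             ≤⟨ ^-monoʳ-≤ 266 (m≤n+m k (suc h)) ⟩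
    266 ^ depth                                         ≤⟨ m≤n*m (266 ^ depth) (51 ^ k) {{m^n≢0 51 k}} ⟩
    51 ^ k * 266 ^ depth                                ≡⟨ cong (_* 266 ^ depth) (*-identityˡ (51 ^ k)) ⟨
    1 * 51 ^ k * 266 ^ depth                            ≤⟨ m≤m*n _ (L (depth + 0) (suc h)) {{>-nonZero positive}} ⟩
    1 * 51 ^ k * 266 ^ depth * L (depth + 0) (suc h)    ∎
    where
    open ≤-Reasoning
    positive : 1 ≤ L (depth + 0) (suc h)
    positive = L-positive (depth + 0) h
      (≤-trans (m≤m+n (suc h) k) (≤-reflexive (sym (+-identityʳ depth))))
  L-lower (suc n) (suc h) 0 eq = ≤-trans (≤-reflexive (*-zeroʳ (266 ^ suc n))) z≤n
  L-lower (suc n) (suc h) 1 eq = ≤-trans (≤-reflexive (*-zeroʳ (266 ^ suc n))) z≤n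
  L-lower (suc n) (suc h) (suc (suc k)) eq rewrite +-suc depth n = begin
    266 * 266 ^ n * G (2 + k)
      ≡⟨ swap 266 (266 ^ n) (G (2 + k)) ⟩
    266 ^ n * (266 * G (2 + k))
      ≤⟨ *-monoʳ-≤ (266 ^ n) (G-step k) ⟩
    266 ^ n * (2 * 51 * G (2 + k) + 2 * 51 ^ 2 * G (1 + k) + 51 ^ 3 * G k + G (3 + k))
      ≡⟨ expand 51 (266 ^ n) (G (3 + k)) (G (2 + k)) (G (1 + k)) (G k) ⟩
    266 ^ n * G (3 + k) + 2 * 51 * (266 ^ n * G (2 + k))
      + 2 * 51 ^ 2 * (266 ^ n * G (1 + k)) + 51 ^ 3 * (266 ^ n * G k)
      ≤⟨ +-mono-≤ (+-mono-≤ (+-mono-≤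
          (L-lower n h (3 + k) (trans (+-suc h (2 + k)) eq))
          (*-monoʳ-≤ (2 * 51) (L-lower n (1 + h) (2 + k) eq)))
          (*-monoʳ-≤ (2 * 51 ^ 2) (L-lower n (2 + h) (1 + k) (trans (sym (+-suc (suc h) (1 + k))) eq))))
          (*-monoʳ-≤ (51 ^ 3) (L-lower n (3 + h) k (trans (sym (trans (+-suc (suc h) (1 + k)) (+-suc (2 + h) k))) eq))) ⟩
    51 ^ n * (51 * (51 * (51 * 51 ^ k))) * 266 ^ depth * L (depth + n) h
      + 2 * 51 * (51 ^ n * (51 * (51 * 51 ^ k)) * 266 ^ depth * L (depth + n) (1 + h))
      + 2 * 51 ^ 2 * (51 ^ n * (51 * 51 ^ k) * 266 ^ depth * L (depth + n) (2 + h))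
      + 51 ^ 3 * (51 ^ n * 51 ^ k * 266 ^ depth * L (depth + n) (3 + h))
      ≡⟨ collect 51 (51 ^ n) (51 ^ k) (266 ^ depth)
          (L (depth + n) h) (L (depth + n) (1 + h)) (L (depth + n) (2 + h)) (L (depth + n) (3 + h)) ⟩
    51 * 51 ^ n * (51 * (51 * 51 ^ k)) * 266 ^ depth
      * (L (depth + n) h + 2 * L (depth + n) (1 + h) + 2 * L (depth + n) (2 + h) + L (depth + n) (3 + h)) ∎
    where
    open ≤-Reasoning
    swap : ∀ x y z → x * y * z ≡ y * (x * z)
    swap = solve-∀
    expand : ∀ u x a b c d →
      x * (2 * u * b + 2 * (u * (u * 1)) * c + u * (u * (u * 1)) * d + a) ≡
      x * a + 2 * u * (x * b) + 2 * (u * (u * 1)) * (x * c) + u * (u * (u * 1)) * (x * d)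
    expand = solve-∀
    collect : ∀ u x y z a b c d →
      x * (u * (u * (u * y))) * z * a + 2 * u * (x * (u * (u * y)) * z * b)
        + 2 * (u * (u * 1)) * (x * (u * y) * z * c) + u * (u * (u * 1)) * (x * y * z * d) ≡
      u * x * (u * (u * y)) * z * (a + 2 * b + 2 * c + d)
    collect = solve-∀

-- Bernoulli's inequality 1 + n/b ≤ (1 + 1/b)ⁿ, cleared of denominators.
bernoulli : ∀ b n → b ^ n * (b + n) ≤ b * suc b ^ n
bernoulli b zero    = ≤-reflexive (base b)
  where
  base : ∀ b → 1 * (b + 0) ≡ b * 1
  base = solve-∀
bernoulli b (suc n) = begin
  b * b ^ n * (b + suc n)          ≤⟨ m≤m+n _ (b ^ n * n) ⟩
  b * b ^ n * (b + suc n) + b ^ n * n ≡⟨ step b (b ^ n) n ⟩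
  suc b * (b ^ n * (b + n))        ≤⟨ *-monoʳ-≤ (suc b) (bernoulli b n) ⟩
  suc b * (b * suc b ^ n)          ≡⟨ swap (suc b) b (suc b ^ n) ⟩
  b * (suc b * suc b ^ n)          ∎
  where
  open ≤-Reasoning
  step : ∀ b x n → b * x * (b + (1 + n)) + x * n ≡ (1 + b) * (x * (b + n))
  step = solve-∀
  swap : ∀ x y z → x * (y * z) ≡ y * (x * z)
  swap = solve-∀

-- At the exponent b (c + n) Bernoulli's inequality gives a ratio of at least 1 + c + n, which
-- exceeds c. The free n makes the exponent as large as desired.
pow-dominates : ∀ b .{{_ : NonZero b}} c n → c * b ^ (b * (c + n)) < suc b ^ (b * (c + n))
pow-dominates b c n = *-cancelˡ-< b _ _ (begin-strict
  b * (c * B)       <⟨ m<m+n _ (>-nonZero⁻¹ (b * B) {{m*n≢0 b B {{it}} {{m^n≢0 b (b * (c + n))}}}}) ⟩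
  b * (c * B) + b * B                 ≤⟨ m≤m+n _ (b * n * B) ⟩
  b * (c * B) + b * B + b * n * B     ≡⟨ collect b c n B ⟩
  B * (b + b * (c + n))               ≤⟨ bernoulli b (b * (c + n)) ⟩
  b * suc b ^ (b * (c + n))           ∎)
  where
  open ≤-Reasoning
  B = b ^ (b * (c + n))
  collect : ∀ b c n B → b * (c * B) + b * B + b * n * B ≡ B * (b + b * (c + n))
  collect = solve-∀

^-distribʳ-* : ∀ a b n → (a * b) ^ n ≡ a ^ n * b ^ n
^-distribʳ-* a b zero    = refl
^-distribʳ-* a b (suc n) = trans (cong (a * b *_) (^-distribʳ-* a b n)) (interchange a b (a ^ n) (b ^ n))
  where
  interchange : ∀ a b x y → a * b * (x * y) ≡ a * x * (b * y)
  interchange = solve-∀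

-- 339/65 lies between 5.215 and 266/51, with 266 · 65 = 339 · 51 + 1.
L-exceeds : ∀ d .{{_ : NonZero (G d)}} → G (suc d) ≡ 0 →
  ∀ N → ∃[ k ] N ≤ k × 339 ^ suc k < 65 ^ suc k * L (suc k) 1
L-exceeds d G-vanishes N = d + n , N≤ , *-cancelˡ-< (51 ^ n * K) _ _ (begin-strict
  51 ^ n * K * 339 ^ (suc d + n)           ≡⟨ cong (51 ^ n * K *_) (^-distribˡ-+-* 339 (suc d) n) ⟩
  51 ^ n * K * (339 ^ suc d * 339 ^ n)     ≡⟨ regroup (51 ^ n) K (339 ^ suc d) (339 ^ n) ⟩
  339 ^ suc d * K * (339 ^ n * 51 ^ n)     ≡⟨ cong (339 ^ suc d * K *_) (^-distribʳ-* 339 51 n) ⟨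
  339 ^ suc d * K * 17289 ^ n              <⟨ pow-dominates 17289 (339 ^ suc d * K) N ⟩
  17290 ^ n                                ≡⟨ ^-distribʳ-* 65 266 n ⟩
  65 ^ n * 266 ^ n                         ≤⟨ *-mono-≤ (^-monoʳ-≤ 65 (m≤n+m n (suc d))) (lower-bound n) ⟩
  65 ^ (suc d + n) * (51 ^ n * K * L (suc d + n) 1)
    ≡⟨ regroup′ (65 ^ (suc d + n)) (51 ^ n * K) (L (suc d + n) 1) ⟩
  51 ^ n * K * (65 ^ (suc d + n) * L (suc d + n) 1) ∎)
  where
  open ≤-Reasoning
  K = 51 ^ d * 266 ^ suc d
  n = 17289 * (339 ^ suc d * K + N)
  lower-bound : ∀ n → 266 ^ n ≤ 51 ^ n * K * L (suc d + n) 1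
  lower-bound n = ≤-trans (m≤m*n (266 ^ n) (G d)) (≤-trans
    (LowerBound.L-lower (suc d) G-vanishes n 1 d refl)
    (≤-reflexive (cong (_* L (suc d + n) 1) (*-assoc (51 ^ n) (51 ^ d) (266 ^ suc d)))))
  N≤ : N ≤ d + n
  N≤ = ≤-trans (m≤n+m N (339 ^ suc d * K)) (≤-trans (m≤n*m _ 17289) (m≤n+m n d))
  regroup : ∀ x k c y → x * k * (c * y) ≡ c * k * (y * x)
  regroup = solve-∀
  regroup′ : ∀ x y z → x * (y * z) ≡ y * (x * z)
  regroup′ = solve-∀

-- From powers of natural numbers to rational cuts

fromℕ-* : ∀ a b → fromℕ (a * b) ≡ fromℕ a ℚ.* fromℕ b
fromℕ-* a b = ℚ.toℚᵘ-injective (begin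
  ℚ.toℚᵘ (fromℕ (a * b))                        ≈⟨ ℚ.toℚᵘ-fromℚᵘ (ℚᵘ.mkℚᵘ (+ (a * b)) 0) ⟩
  ℚᵘ.mkℚᵘ (+ (a * b)) 0                         ≡⟨ cong (λ i → ℚᵘ.mkℚᵘ i 0) (ℤ.pos-* a b) ⟩
  ℚᵘ.mkℚᵘ (+ a) 0 ℚᵘ.* ℚᵘ.mkℚᵘ (+ b) 0         ≈⟨ ℚᵘ.*-cong (ℚ.toℚᵘ-fromℚᵘ (ℚᵘ.mkℚᵘ (+ a) 0)) (ℚ.toℚᵘ-fromℚᵘ (ℚᵘ.mkℚᵘ (+ b) 0)) ⟨
  ℚ.toℚᵘ (fromℕ a) ℚᵘ.* ℚ.toℚᵘ (fromℕ b)        ≈⟨ ℚ.toℚᵘ-homo-* (fromℕ a) (fromℕ b) ⟨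
  ℚ.toℚᵘ (fromℕ a ℚ.* fromℕ b)                  ∎)
  where open ℚᵘ.≃-Reasoning

fromℕ-mono-< : ∀ {a b} → a < b → fromℕ a ℚ.< fromℕ b
fromℕ-mono-< {a} {b} a<b = ℚ.toℚᵘ-cancel-< (begin-strict
  ℚ.toℚᵘ (fromℕ a)   ≃⟨ ℚ.toℚᵘ-fromℚᵘ (ℚᵘ.mkℚᵘ (+ a) 0) ⟩
  ℚᵘ.mkℚᵘ (+ a) 0    <⟨ ℚᵘ.*<* (ℤ.*-monoʳ-<-pos (+ 1) (+<+ a<b)) ⟩
  ℚᵘ.mkℚᵘ (+ b) 0    ≃⟨ ℚ.toℚᵘ-fromℚᵘ (ℚᵘ.mkℚᵘ (+ b) 0) ⟨
  ℚ.toℚᵘ (fromℕ b)   ∎)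
  where open ℚᵘ.≤-Reasoning

fromℕ-nonNegative : ∀ a → ℚ.NonNegative (fromℕ a)
fromℕ-nonNegative a = ℚ.normalize-nonNeg a 1

-- The fraction x = p/q enters only through x q = p, so that comparing a power of x with a natural
-- number becomes a comparison of natural numbers.
^ℚ-fraction : ∀ x p q → x ℚ.* fromℕ q ≡ fromℕ p →
              ∀ n → (x ^ℚ n) ℚ.* fromℕ (q ^ n) ≡ fromℕ (p ^ n)
^ℚ-fraction x p q xq≡p zero    = refl
^ℚ-fraction x p q xq≡p (suc n) = begin
  (x ℚ.* X) ℚ.* fromℕ (q * q ^ n)              ≡⟨ cong ((x ℚ.* X) ℚ.*_) (fromℕ-* q (q ^ n)) ⟩
  (x ℚ.* X) ℚ.* (fromℕ q ℚ.* fromℕ (q ^ n))    ≡⟨ ℚ.*-assoc x X _ ⟩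
  x ℚ.* (X ℚ.* (fromℕ q ℚ.* fromℕ (q ^ n)))    ≡⟨ cong (x ℚ.*_) (ℚ.*-assoc X (fromℕ q) _) ⟨
  x ℚ.* ((X ℚ.* fromℕ q) ℚ.* fromℕ (q ^ n))    ≡⟨ cong (λ y → x ℚ.* (y ℚ.* fromℕ (q ^ n))) (ℚ.*-comm X (fromℕ q)) ⟩
  x ℚ.* ((fromℕ q ℚ.* X) ℚ.* fromℕ (q ^ n))    ≡⟨ cong (x ℚ.*_) (ℚ.*-assoc (fromℕ q) X _) ⟩
  x ℚ.* (fromℕ q ℚ.* (X ℚ.* fromℕ (q ^ n)))    ≡⟨ ℚ.*-assoc x (fromℕ q) _ ⟨
  (x ℚ.* fromℕ q) ℚ.* (X ℚ.* fromℕ (q ^ n))    ≡⟨ cong₂ ℚ._*_ xq≡p (^ℚ-fraction x p q xq≡p n) ⟩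
  fromℕ p ℚ.* fromℕ (p ^ n)                    ≡⟨ fromℕ-* p (p ^ n) ⟨
  fromℕ (p * p ^ n)                            ∎
  where
  open ≡-Reasoning
  X = x ^ℚ n

module _ (x : ℚ) (p q : ℕ) (xq≡p : x ℚ.* fromℕ q ≡ fromℕ p) where

  private
    scaled : ∀ n a → fromℕ (q ^ n * a) ≡ fromℕ a ℚ.* fromℕ (q ^ n)
    scaled n a = trans (fromℕ-* (q ^ n) a) (ℚ.*-comm (fromℕ (q ^ n)) (fromℕ a))

  ^ℚ-<-fromℕ : ∀ n a → p ^ n < q ^ n * a → (x ^ℚ n) ℚ.< fromℕ a
  ^ℚ-<-fromℕ n a pⁿ<qⁿa = ℚ.*-cancelʳ-<-nonNeg (fromℕ (q ^ n)) {{fromℕ-nonNegative (q ^ n)}}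
    (subst₂ ℚ._<_ (sym (^ℚ-fraction x p q xq≡p n)) (scaled n a) (fromℕ-mono-< pⁿ<qⁿa))

  fromℕ-<-^ℚ : ∀ n a → q ^ n * a < p ^ n → fromℕ a ℚ.< (x ^ℚ n)
  fromℕ-<-^ℚ n a qⁿa<pⁿ = ℚ.*-cancelʳ-<-nonNeg (fromℕ (q ^ n)) {{fromℕ-nonNegative (q ^ n)}}
    (subst₂ ℚ._<_ (scaled n a) (sym (^ℚ-fraction x p q xq≡p n)) (fromℕ-mono-< qⁿa<pⁿ))

-- 261/50 lies between 1023/196 and 5.225.
L-below : ∀ k → 50 ^ suc k * L (suc k) 1 < 261 ^ suc k
L-below k = *-cancelˡ-< (196 ^ n) _ _ (begin-strict
  196 ^ n * (50 ^ n * L n 1)   ≡⟨ regroup (196 ^ n) (50 ^ n) (L n 1) ⟩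
  L n 1 * 196 ^ n * 50 ^ n     ≤⟨ *-monoˡ-≤ (50 ^ n) bound ⟩
  1023 ^ n * 50 ^ n            ≡⟨ ^-distribʳ-* 1023 50 n ⟨
  51150 ^ n                    <⟨ ^-monoˡ-< n (toWitness {a? = 51150 <? 51156} tt) ⟩
  51156 ^ n                    ≡⟨ ^-distribʳ-* 196 261 n ⟩
  196 ^ n * 261 ^ n            ∎)
  where
  open ≤-Reasoning
  n = suc k
  regroup : ∀ x y z → x * (y * z) ≡ z * x * y
  regroup = solve-∀
  regroup₇ : ∀ x y → 7 * (x * y) ≡ x * (y * 7)
  regroup₇ = solve-∀
  bound : L n 1 * 196 ^ n ≤ 1023 ^ n
  bound = *-cancelˡ-≤ 7 (begin
    7 * (L n 1 * 196 ^ n)   ≡⟨ regroup₇ (L n 1) (196 ^ n) ⟩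
    L n 1 * (196 ^ n * 7)   ≤⟨ L-upper n 1 ⟩
    1023 ^ n * 4            ≤⟨ *-monoʳ-≤ (1023 ^ n) (m≤m+n 4 3) ⟩
    1023 ^ n * 7            ≡⟨ *-comm (1023 ^ n) 7 ⟩
    7 * 1023 ^ n            ∎)

abstract
  -- By evaluation, 79 is the first index from 2 on at which the truncated recurrence reaches zero,
  -- and `G 78` is still positive. The block is abstract because the witness involves numbers such
  -- as 339 ^ 79, which must never be unfolded.
  L-exceeds-339/65 : ∀ N → ∃[ k ] N ≤ k × 339 ^ suc k < 65 ^ suc k * L (suc k) 1
  L-exceeds-339/65 = L-exceeds 78 refl

growthRate-L : ∀ a → (∀ k → a (suc k) ≡ L (suc k) 1) →
               ∣ growthRate a - (+ 522 / 100) ∣< (+ 5 / 1000)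
growthRate-L a a≡L =
  (+ 339 / 65 , toWitness {a? = ((+ 522 / 100) ℚ.- (+ 5 / 1000)) ℚ.<? (+ 339 / 65)} tt , λ N →
    let k , N≤k , bound = L-exceeds-339/65 N in
    k , N≤k , inj₂ (^ℚ-<-fromℕ (+ 339 / 65) 339 65 refl (suc k) (a (suc k))
      (subst (λ c → 339 ^ suc k < 65 ^ suc k * c) (sym (a≡L k)) bound))) ,
  (+ 261 / 50 , toWitness {a? = (+ 261 / 50) ℚ.<? ((+ 522 / 100) ℚ.+ (+ 5 / 1000))} tt , 0 , λ k _ →
    toWitness {a? = 0ℚ ℚ.<? (+ 261 / 50)} tt ,
    fromℕ-<-^ℚ (+ 261 / 50) 261 50 refl (suc k) (a (suc k))
      (subst (λ c → 50 ^ suc k * c < 261 ^ suc k) (sym (a≡L k)) (L-below k)))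

-- The pushdown automaton and its generating function

-- The mode tells whether the component of the current top interval among the points
-- read so far contains an open bottom block, which is then the last one (attached),
-- or not (floating).  An open block is stored with the mode in which it was opened,
-- which is restored when it closes.
data Mode : Set where
  attached floating : Mode

State : Set
State = Mode × List (ℕ × Mode)

-- (s , f , l) at position i: s holds when i starts a new interval of the top
-- (never set at i = 0), f and l when i is the first, respectively the last,
-- element of its bottom block.
Letter : Set
Letter = Bool × Bool × Bool

join : Mode → Bool → Mode
join attached false = attached
join attached true  = floating
join floating s     = floating

move : ℕ → Mode → Bool → Bool → List (ℕ × Mode) → State
move i m true  true  stk             = m , stk
move i m true  false stk             = attached , (i , m) ∷ stk
move i m false false stk             = attached , stk
-- A default: `connects` rejects a non-first point on an empty stack.
move i m false true  []              = floating , []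
move i m false true  ((t , k) ∷ stk) = k , stk

next : ℕ → Letter → State → State
next i (s , f , l) (m , stk) = move i (join m s) f l stk

-- A floating interval may not end, as its component would be cut off.
separates : Mode → Bool → Bool
separates attached s = true
separates floating s = not s

-- An attached interval may not meet the last open block, as this would close a cycle.
connects : Mode → Bool → List (ℕ × Mode) → Bool
connects m        true  stk     = true
connects attached false stk     = false
connects floating false []      = false
connects floating false (_ ∷ _) = true

legal : Letter → State → Bool
legal (s , f , l) (m , stk) = separates m s ∧ connects (join m s) f stk

accepts : ∀ {k} → ℕ → State → Vec Letter k → Bool
accepts i σ               (x ∷ w) = legal x σ ∧ accepts (suc i) (next i x σ) w
accepts i (floating , []) []      = true
accepts i _               []      = false

sumᵇ : (Bool → ℕ) → ℕ
sumᵇ c = c true + c false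

card : ∀ {k} → (Vec Letter k → Bool) → ℕ
card {zero}  P = if P [] then 1 else 0
card {suc k} P = sumᵇ λ s → sumᵇ λ f → sumᵇ λ l → card (λ w → P ((s , f , l) ∷ w))

Satisfying : ∀ {k} → (Vec Letter k → Bool) → Set
Satisfying {k} P = Σ[ w ∈ Vec Letter k ] P w ≡ true

Satisfying-≡ : ∀ {k} {P : Vec Letter k → Bool} {x y : Satisfying P} → proj₁ x ≡ proj₁ y → x ≡ y
Satisfying-≡ {x = w , p} {.w , q} refl = cong (w ,_) (uip p q)

ΣBool↔Fin : ∀ {F : Bool → Set} {c : Bool → ℕ} → (∀ b → F b ↔ Fin (c b)) → Σ Bool F ↔ Fin (sumᵇ c)
ΣBool↔Fin {F} e = ↔-trans split (↔-trans (e true ⊎-↔ e false) (↔-sym Fin.+↔⊎))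
  where
  split : Σ Bool F ↔ (F true ⊎ F false)
  split = mk↔ₛ′
    (λ { (true , x) → inj₁ x ; (false , x) → inj₂ x })
    [ true ,_ , false ,_ ]′
    (λ { (inj₁ _) → refl ; (inj₂ _) → refl })
    (λ { (true , _) → refl ; (false , _) → refl })

Satisfying↔Fin : ∀ {k} (P : Vec Letter k → Bool) → Satisfying P ↔ Fin (card P)
Satisfying↔Fin {zero} P with P [] in eq
... | true  = ↔-trans (mk↔ₛ′ (λ _ → tt) (λ _ → [] , eq) (λ _ → refl)
                (λ { ([] , e) → cong ([] ,_) (uip eq e) }))
              (↔-sym Fin.1↔⊤)
... | false = ↔-trans (mk↔ₛ′ (λ { ([] , e) → case trans (sym eq) e of λ () }) (λ ()) (λ ())
                (λ { ([] , e) → case trans (sym eq) e of λ () }))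
              (↔-sym Fin.0↔⊥)
Satisfying↔Fin {suc k} P = ↔-trans uncons
  (ΣBool↔Fin λ s → ΣBool↔Fin λ f → ΣBool↔Fin λ l → Satisfying↔Fin (λ w → P ((s , f , l) ∷ w)))
  where
  uncons : Satisfying P ↔
    (Σ[ s ∈ Bool ] Σ[ f ∈ Bool ] Σ[ l ∈ Bool ] Satisfying (λ w → P ((s , f , l) ∷ w)))
  uncons = mk↔ₛ′
    (λ { ((s , f , l) ∷ w , e) → s , f , l , w , e })
    (λ { (s , f , l , w , e) → (s , f , l) ∷ w , e })
    (λ _ → refl)
    (λ { (_ ∷ _ , _) → refl })

-- The generating function of the words accepted from a state is the product of
-- a factor F (floating) or F + F² (attached) for every open block and a final 1 + F
-- or F + F².  A power Fʰ is read as the evaluation of L at height h.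
value : Mode → List (ℕ × Mode) → (ℕ → ℕ) → ℕ → ℕ
value floating []              g j = g j + g (1 + j)
value attached []              g j = g (1 + j) + g (2 + j)
value floating ((_ , k) ∷ stk) g j = value k stk g (1 + j)
value attached ((_ , k) ∷ stk) g j = value k stk g (1 + j) + value k stk g (2 + j)

-- The equation F = x (1 + 2F + 2F² + F³) multiplied by a fixed polynomial in F, read off in
-- coefficients. It starts at height `suc j` because `L (suc n)` is zero at height 0 rather than
-- following the recursion.
value-step : ∀ m stk n j → value m stk (L (suc n)) (suc j) ≡
  value m stk (L n) j + 2 * value m stk (L n) (1 + j)
    + 2 * value m stk (L n) (2 + j) + value m stk (L n) (3 + j)

private
  two-steps : ∀ a b c d e →
    (a + 2 * b + 2 * c + d) + (b + 2 * c + 2 * d + e) ≡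
    (a + b) + 2 * (b + c) + 2 * (c + d) + (d + e)
  two-steps = solve-∀

value-step floating []              n j = two-steps (L n j) (L n (1 + j)) (L n (2 + j)) (L n (3 + j)) (L n (4 + j))
value-step attached []              n j = two-steps (L n (1 + j)) (L n (2 + j)) (L n (3 + j)) (L n (4 + j)) (L n (5 + j))
value-step floating ((_ , k) ∷ stk) n j = value-step k stk n (1 + j)
value-step attached ((_ , k) ∷ stk) n j =
  trans (cong₂ _+_ (value-step k stk n (1 + j)) (value-step k stk n (2 + j)))
        (two-steps (U (1 + j)) (U (2 + j)) (U (3 + j)) (U (4 + j)) (U (5 + j)))
  where
  U = value k stk (L n)

value-zero : ∀ m stk j → value m stk (L 0) (suc j) ≡ 0
value-zero floating []              j = refl
value-zero attached []              j = refl
value-zero floating ((_ , k) ∷ stk) j = value-zero k stk (1 + j)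
value-zero attached ((_ , k) ∷ stk) j = cong₂ _+_ (value-zero k stk (1 + j)) (value-zero k stk (2 + j))

card-false : ∀ k → card {k} (λ _ → false) ≡ 0
card-false zero    = refl
card-false (suc k) rewrite card-false k = refl

-- Let P be `value k stk` for the stack below the last open block. From a floating state the four
-- letters without a new interval lead to F P, (F² + F³) P, (F + F²) P and P, which sum to (1 + 2F +
-- 2F² + F³) P. From an attached state the letters with a new interval give the same sum, and those
-- without one give F times it. An empty stack replaces F P by 1 + F and loses the letters that need
-- an open block.
card-accepts : ∀ k i m stk → card {k} (accepts i (m , stk)) ≡ value m stk (L k) 0
card-accepts zero    i floating []              = refl
card-accepts zero    i attached []              = refl
card-accepts zero    i floating ((_ , k) ∷ stk) = sym (value-zero k stk 0)
card-accepts zero    i attached ((_ , k) ∷ stk) = sym (cong₂ _+_ (value-zero k stk 0) (value-zero k stk 1))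
card-accepts (suc n) i floating []
  rewrite card-false n
        | card-accepts n (suc i) floating []
        | card-accepts n (suc i) attached ((i , floating) ∷ [])
  = count (L n 0) (L n 1) (L n 2) (L n 3)
  where
  count : ∀ a b c d → (a + b + (b + c + (c + d))) + 0 ≡ a + 2 * b + 2 * c + d
  count = solve-∀
card-accepts (suc n) i attached []
  rewrite card-false n
        | card-accepts n (suc i) floating []
        | card-accepts n (suc i) attached []
        | card-accepts n (suc i) attached ((i , floating) ∷ [])
        | card-accepts n (suc i) attached ((i , attached) ∷ [])
  = count (L n 0) (L n 1) (L n 2) (L n 3) (L n 4)
  where
  count : ∀ a b c d e →
    (a + b + (b + c + (c + d))) + 0 + ((b + c + (c + d + (d + e))) + 0) ≡
    (a + 2 * b + 2 * c + d) + (b + 2 * c + 2 * d + e)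
  count = solve-∀
card-accepts (suc n) i floating ((t , k) ∷ stk)
  rewrite card-false n
        | card-accepts n (suc i) floating ((t , k) ∷ stk)
        | card-accepts n (suc i) attached ((t , k) ∷ stk)
        | card-accepts n (suc i) attached ((i , floating) ∷ (t , k) ∷ stk)
        | card-accepts n (suc i) k stk
        | value-step k stk n 0
  = count (U 0) (U 1) (U 2) (U 3)
  where
  U = value k stk (L n)
  count : ∀ a b c d →
    (b + (c + d)) + (a + (b + c)) ≡ a + 2 * b + 2 * c + d
  count = solve-∀
card-accepts (suc n) i attached ((t , k) ∷ stk)
  rewrite card-false n
        | card-accepts n (suc i) floating ((t , k) ∷ stk)
        | card-accepts n (suc i) attached ((t , k) ∷ stk)
        | card-accepts n (suc i) attached ((i , floating) ∷ (t , k) ∷ stk)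
        | card-accepts n (suc i) attached ((i , attached) ∷ (t , k) ∷ stk)
        | card-accepts n (suc i) k stk
        | value-step k stk n 0
        | value-step k stk n 1
  = count (U 0) (U 1) (U 2) (U 3) (U 4)
  where
  U = value k stk (L n)
  count : ∀ a b c d e →
    ((b + (c + d)) + (a + (b + c))) + (((b + c) + (c + d + (d + e))) + 0) ≡
    (a + 2 * b + 2 * c + d) + (b + 2 * c + 2 * d + e)
  count = solve-∀

-- Counting and searching below a bound

does-true⁻¹ : ∀ {P : Set} (P? : Dec P) → does P? ≡ true → P
does-true⁻¹ (yes p) _ = p

does-false⁻¹ : ∀ {P : Set} (P? : Dec P) → does P? ≡ false → ¬ P
does-false⁻¹ (no ¬p) _ = ¬p

cnt : (ℕ → Bool) → ℕ → ℕ
cnt f zero    = 0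
cnt f (suc n) = (if f n then 1 else 0) + cnt f n

cnt-cong : ∀ {f g} n → (∀ {a} → a < n → f a ≡ g a) → cnt f n ≡ cnt g n
cnt-cong zero    f≡g = refl
cnt-cong (suc n) f≡g = cong₂ (λ b c → (if b then 1 else 0) + c) (f≡g ≤-refl) (cnt-cong n (f≡g ∘ m≤n⇒m≤1+n))

cnt-mono : ∀ {f g} n → (∀ {a} → a < n → f a ≡ true → g a ≡ true) → cnt f n ≤ cnt g n
cnt-mono {f} {g} zero    f⇒g = z≤n
cnt-mono {f} {g} (suc n) f⇒g with f n in eq
... | false = ≤-trans (cnt-mono n (f⇒g ∘ m≤n⇒m≤1+n)) (m≤n+m _ _)
... | true rewrite f⇒g ≤-refl eq = s≤s (cnt-mono n (f⇒g ∘ m≤n⇒m≤1+n))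

cnt-insert : ∀ {f g j} n → j < n → f j ≡ true → g j ≡ false →
             (∀ {a} → a < n → a ≢ j → f a ≡ g a) → cnt f n ≡ suc (cnt g n)
cnt-insert {f} {g} {j} (suc n) j<1+n fj gj f≡g with n ≟ j
... | yes refl rewrite fj | gj =
  cong suc (cnt-cong n (λ a<n → f≡g (m≤n⇒m≤1+n a<n) (<⇒≢ a<n)))
... | no n≢j rewrite f≡g ≤-refl n≢j = trans
  (cong (λ c → (if g n then 1 else 0) + c) (cnt-insert n (≤∧≢⇒< (s≤s⁻¹ j<1+n) (n≢j ∘ sym)) fj gj (f≡g ∘ m≤n⇒m≤1+n)))
  (+-suc _ _)

cnt-≤ : ∀ f {k n} → k ≤ n → cnt f k ≤ cnt f n
cnt-≤ f {n = zero}  z≤n = z≤n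
cnt-≤ f {k} {suc n} k≤1+n with m≤n⇒m<n∨m≡n k≤1+n
... | inj₁ k<1+n = ≤-trans (cnt-≤ f (s≤s⁻¹ k<1+n)) (m≤n+m _ _)
... | inj₂ refl  = ≤-refl

cnt-true : ∀ {f} n → (∀ {a} → a < n → f a ≡ true) → cnt f n ≡ n
cnt-true zero    all = refl
cnt-true (suc n) all rewrite all (≤-refl {suc n}) = cong suc (cnt-true n (all ∘ m≤n⇒m≤1+n))

cnt-zero⁻¹ : ∀ {f} n → cnt f n ≡ 0 → ∀ {a} → a < n → f a ≡ false
cnt-zero⁻¹ {f} (suc n) eq {a} a<1+n with f n in fn
... | false with m≤n⇒m<n∨m≡n a<1+n
...   | inj₁ a<n  = cnt-zero⁻¹ n eq (s≤s⁻¹ a<n)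
...   | inj₂ refl = fn

cnt-two : ∀ f {c n} → 0 < c → c < n → f 0 ≡ true → f c ≡ true → 2 ≤ cnt f n
cnt-two f {c} 0<c c<n f0 fc = ≤-trans
  (≤-trans (s≤s (≤-trans (≤-reflexive (step 0 f0)) (cnt-≤ f 0<c))) (≤-reflexive (step c fc)))
  (cnt-≤ f c<n)
  where
  step : ∀ a → f a ≡ true → suc (cnt f a) ≡ cnt f (suc a)
  step a eq rewrite eq = refl

least : ∀ {P : ℕ → Set} → (∀ a → Dec (P a)) → ∀ n →
        (∃[ t ] t < n × P t × (∀ {b} → b < t → ¬ P b)) ⊎ (∀ {b} → b < n → ¬ P b)
least P? zero    = inj₂ λ ()
least P? (suc n) with least P? n | P? n
... | inj₁ (t , t<n , rest) | _     = inj₁ (t , m≤n⇒m≤1+n t<n , rest)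
... | inj₂ none             | yes p = inj₁ (n , ≤-refl , p , none)
... | inj₂ none             | no ¬p = inj₂ λ b<1+n → case m≤n⇒m<n∨m≡n b<1+n of λ
  { (inj₁ b<n) → none (s≤s⁻¹ b<n) ; (inj₂ refl) → ¬p }

greatest : ∀ {P : ℕ → Set} → (∀ a → Dec (P a)) → ∀ n →
           (∃[ t ] t < n × P t × (∀ {b} → t < b → b < n → ¬ P b)) ⊎ (∀ {b} → b < n → ¬ P b)
greatest P? zero    = inj₂ λ ()
greatest P? (suc n) with P? n | greatest P? n
... | yes p | _                            = inj₁ (n , ≤-refl , p , λ n<b b<1+n → contradiction (s≤s⁻¹ b<1+n) (<⇒≱ n<b))
... | no ¬p | inj₁ (t , t<n , pt , above)  = inj₁ (t , m≤n⇒m≤1+n t<n , pt , λ t<b b<1+n → case m≤n⇒m<n∨m≡n b<1+n of λ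
  { (inj₁ b<n) → above t<b (s≤s⁻¹ b<n) ; (inj₂ refl) → ¬p })
... | no ¬p | inj₂ none                    = inj₂ λ b<1+n → case m≤n⇒m<n∨m≡n b<1+n of λ
  { (inj₁ b<n) → none (s≤s⁻¹ b<n) ; (inj₂ refl) → ¬p }

-- Non-crossing labellings

-- A partition of {0,…,n−1} is the kernel of a labelling ℕ → X, whose values
-- from n on are irrelevant.

module _ {X : Set} where

  NonCrossingOn : ℕ → (ℕ → X) → Set
  NonCrossingOn n e = ∀ {a b c d} → a < b → b < c → c < d → d < n →
                      e a ≡ e c → e b ≡ e d → e a ≡ e b

  First : (ℕ → X) → ℕ → Set
  First e a = ∀ b → b < a → e b ≢ e a

  Last : ℕ → (ℕ → X) → ℕ → Set
  Last n e a = ∀ b → b < n → a < b → e b ≢ e a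

  First-injective : ∀ {e : ℕ → X} {a b} → First e a → First e b → e a ≡ e b → a ≡ b
  First-injective {e} {a} {b} fa fb ea≡eb with <-cmp a b
  ... | tri< a<b _ _ = contradiction ea≡eb (fb a a<b)
  ... | tri≈ _ a≡b _ = a≡b
  ... | tri> _ _ b<a = contradiction (sym ea≡eb) (fa b b<a)

  module _ (_≟ˣ_ : DecidableEquality X) where

    first? : ∀ e a → Dec (First e a)
    first? e a = map′ (λ h b → h {b}) (λ h {b} → h b) (allUpTo? (λ b → ¬? (e b ≟ˣ e a)) a)

    last? : ∀ n e a → Dec (Last n e a)
    last? n e a = map′ (λ h b → h {b}) (λ h {b} → h b) (allUpTo? (λ b → (a <? b) →-dec ¬? (e b ≟ˣ e a)) n)

    firstOf : ∀ e a → ∃[ t ] t ≤ a × First e t × e t ≡ e a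
    firstOf e a with least (λ b → e b ≟ˣ e a) (suc a)
    ... | inj₁ (t , t<1+a , et≡ea , none) = t , s≤s⁻¹ t<1+a , (λ b b<t eb≡et → none b<t (trans eb≡et et≡ea)) , et≡ea
    ... | inj₂ none = contradiction refl (none ≤-refl)

    ¬First⇒earlier : ∀ e a → ¬ First e a → ∃[ t ] t < a × e t ≡ e a
    ¬First⇒earlier e a ¬first with firstOf e a
    ... | t , t≤a , first-t , et≡ea with m≤n⇒m<n∨m≡n t≤a
    ...   | inj₁ t<a  = t , t<a , et≡ea
    ...   | inj₂ refl = contradiction first-t ¬first

    lastOf : ∀ n e a → a < n → ∃[ t ] a ≤ t × t < n × Last n e t × e t ≡ e a
    lastOf n e a a<n with greatest (λ b → e b ≟ˣ e a) n
    ... | inj₂ none = contradiction refl (none a<n)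
    ... | inj₁ (t , t<n , et≡ea , above) =
      t , ≮⇒≥ (λ t<a → above t<a a<n refl) , t<n , (λ b b<n t<b eb≡et → above t<b b<n (trans eb≡et et≡ea)) , et≡ea

    -- Blocks are counted through their minima, so that no quotient of the points is formed.
    blockCount : ℕ → (ℕ → X) → ℕ
    blockCount n e = cnt (λ a → does (first? e a)) n

window : ℕ → ℕ → ℕ → Bool
window p q a = does ((p ≤? a) ×-dec (a <? q))

window-true : ∀ p q a → p ≤ a → a < q → window p q a ≡ true
window-true p q a p≤a a<q = dec-true ((p ≤? a) ×-dec (a <? q)) (p≤a , a<q)

window-false : ∀ p q a → ¬ (p ≤ a × a < q) → window p q a ≡ false
window-false p q a = dec-false ((p ≤? a) ×-dec (a <? q))

window-true⁻¹ : ∀ p q a → window p q a ≡ true → p ≤ a × a < q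
window-true⁻¹ p q a = does-true⁻¹ ((p ≤? a) ×-dec (a <? q))

window-nonCrossing : ∀ n p q → NonCrossingOn n (window p q)
window-nonCrossing n p q {a} {b} {c} {d} a<b b<c c<d d<n a∼c b∼d
  with window p q a in wa | window p q b in wb
... | true  | true  = refl
... | false | false = refl
... | true  | false = trans (sym (window-true p q b
  (≤-trans (proj₁ (window-true⁻¹ p q a wa)) (<⇒≤ a<b))
  (<-trans b<c (proj₂ (window-true⁻¹ p q c (sym a∼c)))))) wb
... | false | true  = trans a∼c (window-true p q c
  (≤-trans (proj₁ (window-true⁻¹ p q b wb)) (<⇒≤ b<c))
  (<-trans c<d (proj₂ (window-true⁻¹ p q d (sym b∼d)))))

meet-nonCrossing : ∀ {X Y : Set} {n} {e : ℕ → X} {f : ℕ → Y} →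
  NonCrossingOn n e → NonCrossingOn n f → NonCrossingOn n (λ a → e a , f a)
meet-nonCrossing nc-e nc-f a<b b<c c<d d<n a∼c b∼d = cong₂ _,_
  (nc-e a<b b<c c<d d<n (cong proj₁ a∼c) (cong proj₁ b∼d))
  (nc-f a<b b<c c<d d<n (cong proj₂ a∼c) (cong proj₂ b∼d))

-- The chords from p to q and from x to y cross unless x is an endpoint of the first one.
meets-both-sides : ∀ {X : Set} {n} {e : ℕ → X} → NonCrossingOn n e →
  ∀ {p q x y} → e p ≡ e q → p ≤ x → x ≤ q → q < n → y < n → (y < p ⊎ q < y) →
  e x ≡ e y → e x ≡ e p
meets-both-sides nc {p} {q} {x} {y} p∼q p≤x x≤q q<n y<n out x∼y
  with m≤n⇒m<n∨m≡n p≤x | m≤n⇒m<n∨m≡n x≤q | out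
... | inj₂ refl | _         | _         = refl
... | _         | inj₂ refl | _         = sym p∼q
... | inj₁ p<x  | inj₁ x<q  | inj₁ y<p  = trans x∼y (nc y<p p<x x<q q<n (sym x∼y) p∼q)
... | inj₁ p<x  | inj₁ x<q  | inj₂ q<y  = sym (nc p<x x<q q<y y<n p∼q x∼y)

-- Non-crossing partitions as kernels, refinement and splitting

module _ {m : ℕ} where

  private
    n = suc m

  -- Extends the points to all of ℕ, so that a partition becomes a labelling of natural numbers and
  -- positions can be handled by plain arithmetic.
  clamp : ℕ → Fin n
  clamp a = fromℕ< {a ⊓ m} (s≤s (m⊓n≤n a m))

  toℕ-clamp : ∀ {a} → a < n → toℕ (clamp a) ≡ a
  toℕ-clamp {a} a<n = trans (Fin.toℕ-fromℕ< _) (m≤n⇒m⊓n≡m (s≤s⁻¹ a<n))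

  clamp-toℕ : ∀ i → clamp (toℕ i) ≡ i
  clamp-toℕ i = Fin.toℕ-injective (toℕ-clamp (Fin.toℕ<n i))

  infix 4 _≟ˢ_
  _≟ˢ_ : DecidableEquality (Subset n)
  _≟ˢ_ = Vec.≡-dec _≟ᵇ_

  cls : NC n → ℕ → Subset n
  cls (π , _) a = block π (clamp a)

  cls-toℕ : ∀ π i → cls π (toℕ i) ≡ block (proj₁ π) i
  cls-toℕ (π , _) i = cong (block π) (clamp-toℕ i)

  cls-nonCrossing : ∀ π → NonCrossingOn n (cls π)
  cls-nonCrossing (π , nc) {a} {b} {c} {d} a<b b<c c<d d<n a∼c b∼d =
    decidable-stable (_ ≟ˢ _) λ a≁b → nc (block π (clamp a)) (block π (clamp b)) (_ , refl) (_ , refl) a≁b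
      (clamp a , clamp b , clamp c , clamp d ,
       (mono b<n a<b , mono c<n b<c , mono d<n c<d) ,
       (block-self π _ , subst (clamp c ∈_) (sym a∼c) (block-self π _)) ,
       (block-self π _ , subst (clamp d ∈_) (sym b∼d) (block-self π _)))
    where
    c<n = <-trans c<d d<n
    b<n = <-trans b<c c<n
    mono : ∀ {x y} → y < n → x < y → clamp x Fin.< clamp y
    mono y<n x<y = subst₂ _<_ (sym (toℕ-clamp (<-trans x<y y<n))) (sym (toℕ-clamp y<n)) x<y

  module _ {X : Set} (_≟ˣ_ : DecidableEquality X) (e : ℕ → X) where

    private
      related : X → Fin n → Bool
      related x i = does (e (toℕ i) ≟ˣ x)

      kernelBlock : Fin n → Subset n
      kernelBlock i = tabulate (related (e (toℕ i)))

      ∈⇒≡ : ∀ {i j} → j ∈ kernelBlock i → e (toℕ j) ≡ e (toℕ i)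
      ∈⇒≡ {i} {j} j∈ = does-true⁻¹ (_ ≟ˣ _)
        (trans (sym (Vec.lookup∘tabulate (related (e (toℕ i))) j)) (Vec.[]=⇒lookup j∈))

      ≡⇒∈ : ∀ {i j} → e (toℕ j) ≡ e (toℕ i) → j ∈ kernelBlock i
      ≡⇒∈ {i} {j} eq = Vec.lookup⇒[]= j (kernelBlock i)
        (trans (Vec.lookup∘tabulate (related (e (toℕ i))) j) (dec-true (_ ≟ˣ _) eq))

    kernel : NonCrossingOn n e → NC n
    kernel nc = π , λ { V W (i , refl) (j , refl) V≢W (a , b , c , d , (a<b , b<c , c<d) , (a∈V , c∈V) , (b∈W , d∈W)) →
        V≢W (trans (sym (block-same π a∈V)) (trans
          (cong (tabulate ∘ related) (nc a<b b<c c<d (Fin.toℕ<n d) (trans (∈⇒≡ a∈V) (sym (∈⇒≡ c∈V))) (trans (∈⇒≡ b∈W) (sym (∈⇒≡ d∈W)))))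
          (block-same π b∈W))) }
      where
      π : Partition n
      π = record
        { block      = kernelBlock
        ; block-self = λ i → ≡⇒∈ refl
        ; block-same = λ j∈ → cong (tabulate ∘ related) (∈⇒≡ j∈)
        }

    module _ (nc : NonCrossingOn n e) {a b} (a<n : a < n) (b<n : b < n) where

      kernel⁺ : e a ≡ e b → cls (kernel nc) a ≡ cls (kernel nc) b
      kernel⁺ eq = cong (tabulate ∘ related)
        (trans (cong e (toℕ-clamp a<n)) (trans eq (cong e (sym (toℕ-clamp b<n)))))

      kernel⁻ : cls (kernel nc) a ≡ cls (kernel nc) b → e a ≡ e b
      kernel⁻ eq = trans (cong e (sym (toℕ-clamp a<n))) (trans
        (∈⇒≡ (subst (clamp a ∈_) eq (block-self (proj₁ (kernel nc)) (clamp a))))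
        (cong e (toℕ-clamp b<n)))

  infix 4 _⊑_
  _⊑_ : NC n → NC n → Set
  π ⊑ ρ = ∀ {a b} → a < n → b < n → cls π a ≡ cls π b → cls ρ a ≡ cls ρ b

  ≼⇒⊑ : ∀ π ρ → π ≼ ρ → π ⊑ ρ
  ≼⇒⊑ π ρ π≼ρ {a} {b} _ _ a∼b = sym (block-same (proj₁ ρ)
    (≤⇒block-⊆ π ρ π≼ρ (clamp a) (subst (clamp b ∈_) (sym a∼b) (block-self (proj₁ π) (clamp b)))))

  ⊑⇒≼ : ∀ π ρ → π ⊑ ρ → π ≼ ρ
  ⊑⇒≼ π ρ π⊑ρ V (i , refl) = block (proj₁ ρ) i , (i , refl) , λ {j} j∈V →
    subst (j ∈_) (trans (sym (cls-toℕ ρ j)) (trans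
      (π⊑ρ (Fin.toℕ<n j) (Fin.toℕ<n i)
        (trans (cls-toℕ π j) (trans (block-same (proj₁ π) j∈V) (sym (cls-toℕ π i)))))
      (cls-toℕ ρ i)))
      (block-self (proj₁ ρ) j)

  ≈⇒⊑ : ∀ π ρ → π ≈ ρ → π ⊑ ρ
  ≈⇒⊑ π ρ π≈ρ _ _ a∼b = trans (sym (π≈ρ _)) (trans a∼b (π≈ρ _))

  ⊑-antisym : ∀ π ρ → π ⊑ ρ → ρ ⊑ π → π ≈ ρ
  ⊑-antisym π ρ π⊑ρ ρ⊑π = Poset.antisym (NC-poset n) {π} {ρ} (⊑⇒≼ π ρ π⊑ρ) (⊑⇒≼ ρ π ρ⊑π)

  ≈-stable : ∀ π ρ → ¬ ¬ π ≈ ρ → π ≈ ρ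
  ≈-stable π ρ ¬¬π≈ρ i = decidable-stable (_ ≟ˢ _) λ πi≢ρi → ¬¬π≈ρ λ π≈ρ → πi≢ρi (π≈ρ i)

  clsFirst? : ∀ π a → Dec (First (cls π) a)
  clsFirst? π = first? _≟ˢ_ (cls π)

  rank : NC n → ℕ
  rank π = blockCount _≟ˢ_ n (cls π)

  First-antitone : ∀ π ρ → π ⊑ ρ → ∀ {a} → a < n → First (cls ρ) a → First (cls π) a
  First-antitone π ρ π⊑ρ a<n first b b<a b∼a = first b b<a (π⊑ρ (<-trans b<a a<n) a<n b∼a)

  rank-antitone : ∀ π ρ → π ⊑ ρ → rank ρ ≤ rank π
  rank-antitone π ρ π⊑ρ = cnt-mono n λ {a} a<n first → dec-true (clsFirst? π a)
    (First-antitone π ρ π⊑ρ a<n (does-true⁻¹ (clsFirst? ρ a) first))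

  -- The block of j in σ is cut in two along the convex hull of the block of j in π.
  record Split (π σ : NC n) (j : ℕ) : Set where
    field
      middle      : NC n
      below       : π ⊑ middle
      above       : middle ⊑ σ
      rank-middle : rank middle ≡ suc (rank σ)
      j<n         : j < n
      other       : ℕ
      other<n     : other < n
      other∼j     : cls σ other ≡ cls σ j
      two-parts   : ∀ {a b} → a < n → b < n → cls σ a ≡ cls σ b →
        cls middle a ≡ cls middle b
        ⊎ (cls middle a ≡ cls middle j × cls middle b ≡ cls middle other)
        ⊎ (cls middle a ≡ cls middle other × cls middle b ≡ cls middle j)

  -- The middle partition is the meet of σ with the window [j , q], where q is the last element of
  -- the block of j in π. By `meets-both-sides` a block of π or σ with points on both sides of this
  -- window must be the block of j. Hence no block of π is cut, and in σ only the block of j is. The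
  -- earlier element t of that block stays outside, so the outer part keeps its old minimum and j is
  -- the only new one.
  split : ∀ π σ → π ⊑ σ → ∀ {j} → j < n → First (cls π) j → ¬ First (cls σ) j → Split π σ j
  split π σ π⊑σ {j} j<n first-j ¬first-j with ¬First⇒earlier _≟ˢ_ (cls σ) j ¬first-j | lastOf _≟ˢ_ n (cls π) j j<n
  ... | t , t<j , t∼j | q , j≤q , q<n , last-q , q∼j = record
    { middle = τ ; below = π⊑τ ; above = λ a<n b<n → cong proj₁ ∘ τ⁻ a<n b<n ; j<n = j<n
    ; rank-middle = cnt-insert n j<n (dec-true (clsFirst? τ j) first-τ-j) (dec-false (clsFirst? σ j) ¬first-j)
        λ {a} a<n a≢j → does-⇔ (mk⇔ (first-σ a<n a≢j) (First-antitone τ σ (λ x<n y<n → cong proj₁ ∘ τ⁻ x<n y<n) a<n))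
                        (clsFirst? τ a) (clsFirst? σ a)
    ; other = t ; other<n = t<n ; other∼j = t∼j ; two-parts = parts }
    where
    t<n = <-trans t<j j<n
    inside : ℕ → Bool
    inside = window j (suc q)
    e : ℕ → Subset n × Bool
    e a = cls σ a , inside a
    nc = meet-nonCrossing (cls-nonCrossing σ) (window-nonCrossing n j (suc q))
    τ = kernel (Product.≡-dec _≟ˢ_ _≟ᵇ_) e nc
    τ⁺ : ∀ {a b} → a < n → b < n → e a ≡ e b → cls τ a ≡ cls τ b
    τ⁺ = kernel⁺ (Product.≡-dec _≟ˢ_ _≟ᵇ_) e nc
    τ⁻ : ∀ {a b} → a < n → b < n → cls τ a ≡ cls τ b → e a ≡ e b
    τ⁻ = kernel⁻ (Product.≡-dec _≟ˢ_ _≟ᵇ_) e nc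
    inside-j : inside j ≡ true
    inside-j = window-true j (suc q) j ≤-refl (s≤s j≤q)
    outside : ∀ a → a < j → inside a ≡ false
    outside a a<j = window-false j (suc q) a λ (j≤a , _) → <⇒≱ a<j j≤a
    bounds : ∀ a → inside a ≡ true → j ≤ a × a ≤ q
    bounds a eq = let j≤a , a<1+q = window-true⁻¹ j (suc q) a eq in j≤a , s≤s⁻¹ a<1+q
    beyond : ∀ a → inside a ≡ false → a < j ⊎ q < a
    beyond a eq with a <? j | q <? a
    ... | yes a<j | _       = inj₁ a<j
    ... | no _    | yes q<a = inj₂ q<a
    ... | no a≮j  | no q≮a  = case trans (sym eq) (window-true j (suc q) a (≮⇒≥ a≮j) (s≤s (≮⇒≥ q≮a))) of λ ()
    cut : ∀ ρ → π ⊑ ρ → ∀ {a b} → b < n → inside a ≡ true → inside b ≡ false →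
          cls ρ a ≡ cls ρ b → cls ρ a ≡ cls ρ j
    cut ρ π⊑ρ {a} {b} b<n in-a out-b = let j≤a , a≤q = bounds a in-a in
      meets-both-sides (cls-nonCrossing ρ) (π⊑ρ j<n q<n (sym q∼j)) j≤a a≤q q<n b<n (beyond b out-b)
    uncut : ∀ {a b} → b < n → inside a ≡ true → inside b ≡ false → cls π a ≢ cls π b
    uncut {a} {b} b<n in-a out-b a∼b with beyond b out-b | cut π (λ _ _ p → p) {a} b<n in-a out-b a∼b
    ... | inj₁ b<j | a∼j = first-j b b<j (trans (sym a∼b) a∼j)
    ... | inj₂ q<b | a∼j = last-q b b<n q<b (trans (sym a∼b) (trans a∼j (sym q∼j)))
    π⊑τ : π ⊑ τ
    π⊑τ {a} {b} a<n b<n a∼b = τ⁺ a<n b<n (cong₂ _,_ (π⊑σ a<n b<n a∼b) same)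
      where
      same : inside a ≡ inside b
      same with inside a in in-a | inside b in in-b
      ... | true  | true  = refl
      ... | false | false = refl
      ... | true  | false = contradiction a∼b (uncut b<n in-a in-b)
      ... | false | true  = contradiction (sym a∼b) (uncut a<n in-b in-a)
    first-τ-j : First (cls τ) j
    first-τ-j b b<j b∼j = case trans (sym (outside b b<j)) (trans (cong proj₂ (τ⁻ (<-trans b<j j<n) j<n b∼j)) inside-j) of λ ()
    first-σ : ∀ {a} → a < n → a ≢ j → First (cls τ) a → First (cls σ) a
    first-σ {a} a<n a≢j first-τ b b<a b∼a with inside b in in-b | inside a in in-a
    ... | true  | true  = first-τ b b<a (τ⁺ (<-trans b<a a<n) a<n (cong₂ _,_ b∼a (trans in-b (sym in-a))))
    ... | false | false = first-τ b b<a (τ⁺ (<-trans b<a a<n) a<n (cong₂ _,_ b∼a (trans in-b (sym in-a))))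
    ... | false | true  = first-τ j (≤∧≢⇒< (proj₁ (bounds a in-a)) (a≢j ∘ sym))
      (τ⁺ j<n a<n (cong₂ _,_ (sym (cut σ π⊑σ (<-trans b<a a<n) in-a in-b (sym b∼a))) (trans inside-j (sym in-a))))
    ... | true  | false = first-τ t (<-trans (<-≤-trans t<j (proj₁ (bounds b in-b))) b<a)
      (τ⁺ t<n a<n (cong₂ _,_ (trans t∼j (trans (sym (cut σ π⊑σ a<n in-b in-a b∼a)) b∼a)) (trans (outside t t<j) (sym in-a))))
    parts : ∀ {a b} → a < n → b < n → cls σ a ≡ cls σ b →
      cls τ a ≡ cls τ b ⊎ (cls τ a ≡ cls τ j × cls τ b ≡ cls τ t) ⊎ (cls τ a ≡ cls τ t × cls τ b ≡ cls τ j)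
    parts {a} {b} a<n b<n a∼b with inside a in in-a | inside b in in-b
    ... | true  | true  = inj₁ (τ⁺ a<n b<n (cong₂ _,_ a∼b (trans in-a (sym in-b))))
    ... | false | false = inj₁ (τ⁺ a<n b<n (cong₂ _,_ a∼b (trans in-a (sym in-b))))
    ... | true  | false = let a∼j = cut σ π⊑σ b<n in-a in-b a∼b in inj₂ (inj₁
      ( τ⁺ a<n j<n (cong₂ _,_ a∼j (trans in-a (sym inside-j)))
      , τ⁺ b<n t<n (cong₂ _,_ (trans (sym a∼b) (trans a∼j (sym t∼j))) (trans in-b (sym (outside t t<j))))))
    ... | false | true  = let b∼j = cut σ π⊑σ a<n in-b in-a (sym a∼b) in inj₂ (inj₂
      ( τ⁺ a<n t<n (cong₂ _,_ (trans a∼b (trans b∼j (sym t∼j))) (trans in-a (sym (outside t t<j))))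
      , τ⁺ b<n j<n (cong₂ _,_ b∼j (trans in-b (sym inside-j)))))

-- Covers, rank and walks

module _ {m : ℕ} where

  private
    n = suc m

  open Poset (NC-poset n) using (module Eq)
    renaming (≤-respˡ-≈ to ≼-respˡ-≈; ≤-respʳ-≈ to ≼-respʳ-≈)

  rank-≈ : ∀ (π ρ : NC n) → π ≈ ρ → rank π ≡ rank ρ
  rank-≈ π ρ π≈ρ = ≤-antisym
    (rank-antitone ρ π (≈⇒⊑ ρ π (Eq.sym {x = π} {ρ} π≈ρ)))
    (rank-antitone π ρ (≈⇒⊑ π ρ π≈ρ))

  -- If every minimum of a block of π is also one of a block of σ, a block of σ cannot contain two
  -- blocks of π, since their minima would both be its minimum.
  equal-or-split : ∀ (π σ : NC n) → π ⊑ σ → π ≈ σ ⊎ (∃[ j ] Split π σ j)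
  equal-or-split π σ π⊑σ
    with anyUpTo? (λ j → clsFirst? π j ×-dec ¬? (clsFirst? σ j)) n
  ... | yes (j , j<n , first-π , ¬first-σ) = inj₂ (j , split π σ π⊑σ j<n first-π ¬first-σ)
  ... | no none = inj₁ (⊑-antisym π σ π⊑σ σ⊑π)
    where
    first-σ : ∀ {j} → j < n → First (cls π) j → First (cls σ) j
    first-σ {j} j<n first-π = decidable-stable (clsFirst? σ j) λ ¬first-σ → none (j , j<n , first-π , ¬first-σ)
    σ⊑π : σ ⊑ π
    σ⊑π {a} {b} a<n b<n a∼b
      with firstOf _≟ˢ_ (cls π) a | firstOf _≟ˢ_ (cls π) b
    ... | s , s≤a , first-s , s∼a | t , t≤b , first-t , t∼b =
      trans (sym s∼a) (trans (cong (cls π) s≡t) t∼b)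
      where
      s<n = ≤-<-trans s≤a a<n
      t<n = ≤-<-trans t≤b b<n
      s≡t : s ≡ t
      s≡t = First-injective (first-σ s<n first-s) (first-σ t<n first-t)
        (trans (π⊑σ s<n a<n s∼a) (trans a∼b (sym (π⊑σ t<n b<n t∼b))))

  rank-strict : ∀ (π σ : NC n) → π ⊏ σ → rank σ < rank π
  rank-strict π σ (π≼σ , π≉σ) with equal-or-split π σ (≼⇒⊑ π σ π≼σ)
  ... | inj₁ π≈σ     = contradiction π≈σ π≉σ
  ... | inj₂ (j , s) = ≤-trans (≤-reflexive (sym (Split.rank-middle s)))
    (rank-antitone π (Split.middle s) (λ a<n b<n → Split.below s a<n b<n))

  rank-suc⇒⋖ : ∀ (π σ : NC n) → π ⊑ σ → rank π ≡ suc (rank σ) → π ⋖ σ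
  rank-suc⇒⋖ π σ π⊑σ eq =
    (⊑⇒≼ π σ π⊑σ , λ π≈σ → 1+n≢n (trans (sym eq) (rank-≈ π σ π≈σ))) ,
    λ τ (π⊏τ , τ⊏σ) → <⇒≱ (rank-strict τ σ τ⊏σ)
      (s≤s⁻¹ (≤-trans (rank-strict π τ π⊏τ) (≤-reflexive eq)))

  -- The middle of a split lies strictly below σ, so it cannot lie strictly above π. This only
  -- refutes their inequality; `≈-stable` turns that into equality.
  ⋖⇒Split : ∀ (π σ : NC n) → π ⋖ σ → ∃[ j ] Σ[ s ∈ Split π σ j ] π ≈ Split.middle s
  ⋖⇒Split π σ ((π≼σ , π≉σ) , nothing-between) with equal-or-split π σ (≼⇒⊑ π σ π≼σ)
  ... | inj₁ π≈σ     = contradiction π≈σ π≉σ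
  ... | inj₂ (j , s) = j , s , ≈-stable π middle λ π≉middle → nothing-between middle
    ( (⊑⇒≼ π middle (λ a<n b<n → below a<n b<n) , π≉middle)
    , proj₁ (rank-suc⇒⋖ middle σ (λ a<n b<n → above a<n b<n) rank-middle))
    where open Split s

  Adjacent-respˡ : ∀ {π π′ σ : NC n} → π ≈ π′ → Adjacent π σ → Adjacent π′ σ
  Adjacent-respˡ {π} {π′} {σ} π≈π′ (inj₁ ((π≼σ , π≉σ) , no-between)) = inj₁
    ( (≼-respˡ-≈ {σ} {π} {π′} π≈π′ π≼σ , λ π′≈σ → π≉σ (Eq.trans {π} {π′} {σ} π≈π′ π′≈σ))
    , λ τ ((π′≼τ , π′≉τ) , τ⊏σ) → no-between τ
      ( (≼-respˡ-≈ {τ} {π′} {π} (Eq.sym {π} {π′} π≈π′) π′≼τ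
        , λ π≈τ → π′≉τ (Eq.trans {π′} {π} {τ} (Eq.sym {π} {π′} π≈π′) π≈τ)) , τ⊏σ))
  Adjacent-respˡ {π} {π′} {σ} π≈π′ (inj₂ ((σ≼π , σ≉π) , no-between)) = inj₂
    ( (≼-respʳ-≈ {σ} {π} {π′} π≈π′ σ≼π
      , λ σ≈π′ → σ≉π (Eq.trans {σ} {π′} {π} σ≈π′ (Eq.sym {π} {π′} π≈π′)))
    , λ τ (σ⊏τ , (τ≼π′ , τ≉π′)) → no-between τ
      ( σ⊏τ , (≼-respʳ-≈ {τ} {π′} {π} (Eq.sym {π} {π′} π≈π′) τ≼π′
              , λ τ≈π → τ≉π′ (Eq.trans {τ} {π} {π′} τ≈π π≈π′))))

  Walk-respˡ : ∀ {k} {π π′ ρ : NC n} → π ≈ π′ → Walk k π ρ → Walk k π′ ρ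
  Walk-respˡ {π = π} {π′} {ρ} π≈π′ (nil π≈ρ) = nil (Eq.trans {π′} {π} {ρ} (Eq.sym {π} {π′} π≈π′) π≈ρ)
  Walk-respˡ {π = π} {π′} π≈π′ (cons {σ = σ} adj w) = cons {σ = σ} (Adjacent-respˡ {π} {π′} {σ} π≈π′ adj) w

  rank-split : ∀ d (π σ : NC n) {j} (s : Split π σ j) → rank π ≡ d + rank σ →
               ∃[ d′ ] d ≡ suc d′ × rank π ≡ d′ + rank (Split.middle s)
  rank-split zero π σ s eq = contradiction eq (>⇒≢ (≤-trans (≤-reflexive (sym (Split.rank-middle s)))
    (rank-antitone π (Split.middle s) (λ a<n b<n → Split.below s a<n b<n))))
  rank-split (suc d) π σ s eq =
    d , refl , trans eq (trans (sym (+-suc d (rank σ))) (cong (λ r → d + r) (sym (Split.rank-middle s))))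

  -- The chain from π to σ is built from its upper end: a split gives an element covered by σ, and
  -- the step from it to σ is put in front of the walk. This avoids concatenating walks.
  ascend : ∀ d {k} (π σ ρ : NC n) → π ⊑ σ → rank π ≡ d + rank σ → Walk k σ ρ → Walk (d + k) π ρ
  ascend d π σ ρ π⊑σ eq w with equal-or-split π σ π⊑σ
  ascend d π σ ρ π⊑σ eq w | inj₁ π≈σ
    rewrite +-cancelʳ-≡ (rank σ) d 0 (trans (sym eq) (rank-≈ π σ π≈σ)) =
    Walk-respˡ (Eq.sym {π} {σ} π≈σ) w
  ascend d {k} π σ ρ π⊑σ eq w | inj₂ (j , s) with rank-split d π σ s eq
  ... | d′ , refl , eq′ = subst (λ l → Walk l π ρ) (+-suc d′ k)
    (ascend d′ π middle ρ (λ a<n b<n → below a<n b<n) eq′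
      (cons (inj₁ (rank-suc⇒⋖ middle σ (λ a<n b<n → above a<n b<n) rank-middle)) w))
    where open Split s

  descend : ∀ d {k} (π σ ρ : NC n) → π ⊑ σ → rank π ≡ d + rank σ → Walk k π ρ → Walk (d + k) σ ρ
  descend d π σ ρ π⊑σ eq w with equal-or-split π σ π⊑σ
  descend d π σ ρ π⊑σ eq w | inj₁ π≈σ
    rewrite +-cancelʳ-≡ (rank σ) d 0 (trans (sym eq) (rank-≈ π σ π≈σ)) =
    Walk-respˡ π≈σ w
  descend d {k} π σ ρ π⊑σ eq w | inj₂ (j , s) with rank-split d π σ s eq
  ... | d′ , refl , eq′ = cons (inj₂ (rank-suc⇒⋖ middle σ (λ a<n b<n → above a<n b<n) rank-middle))
    (descend d′ π middle ρ (λ a<n b<n → below a<n b<n) eq′ w)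
    where open Split s

  walk-above : ∀ d d′ (π ρ τ : NC n) → π ⊑ τ → ρ ⊑ τ → rank π ≡ d + rank τ → rank ρ ≡ d′ + rank τ →
               Walk (d + (d′ + 0)) π ρ
  walk-above d d′ π ρ τ π⊑τ ρ⊑τ eq eq′ =
    ascend d π τ ρ π⊑τ eq (descend d′ ρ τ ρ ρ⊑τ eq′ (nil (Eq.refl {ρ})))

  walk-below : ∀ d d′ (π ρ τ : NC n) → τ ⊑ π → τ ⊑ ρ → rank τ ≡ d + rank π → rank τ ≡ d′ + rank ρ →
               Walk (d + (d′ + 0)) π ρ
  walk-below d d′ π ρ τ τ⊑π τ⊑ρ eq eq′ =
    descend d τ π ρ τ⊑π eq (ascend d′ τ ρ ρ τ⊑ρ eq′ (nil (Eq.refl {ρ})))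

  one : NC n
  one = kernel _≟_ (λ _ → 0) (λ _ _ _ _ _ _ → refl)

  ⊑-one : ∀ (π : NC n) → π ⊑ one
  ⊑-one π a<n b<n _ = kernel⁺ _≟_ (λ _ → 0) (λ _ _ _ _ _ _ → refl) a<n b<n refl

  rank-one : rank one ≡ 1
  rank-one = trans (cnt-insert {g = λ _ → false} n (s≤s z≤n) (dec-true (clsFirst? one 0) (λ _ ())) refl
      λ {a} a<n a≢0 → dec-false (clsFirst? one a) λ first →
        first 0 (n≢0⇒n>0 a≢0) (kernel⁺ _≟_ (λ _ → 0) (λ _ _ _ _ _ _ → refl) (s≤s z≤n) a<n refl))
    (cong suc (none n))
    where
    none : ∀ n → cnt (λ _ → false) n ≡ 0
    none zero    = refl
    none (suc n) = none n

  private
    id-nonCrossing : NonCrossingOn n id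
    id-nonCrossing a<b b<c _ _ a≡c _ = contradiction a≡c (<⇒≢ (<-trans a<b b<c))

  discrete : NC n
  discrete = kernel _≟_ id id-nonCrossing

  discrete⁻ : ∀ {a b} → a < n → b < n → cls discrete a ≡ cls discrete b → a ≡ b
  discrete⁻ = kernel⁻ _≟_ id id-nonCrossing

  discrete-⊑ : ∀ (π : NC n) → discrete ⊑ π
  discrete-⊑ π a<n b<n a∼b = cong (cls π) (discrete⁻ a<n b<n a∼b)

  rank-discrete : rank discrete ≡ n
  rank-discrete = cnt-true n λ {a} a<n → dec-true (clsFirst? discrete a) λ b b<a b∼a →
    <⇒≢ b<a (discrete⁻ (<-trans b<a a<n) a<n b∼a)

  rank-positive : ∀ (π : NC n) → 1 ≤ rank π
  rank-positive π = ≤-trans (≤-reflexive (sym rank-one)) (rank-antitone π one (⊑-one π))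

  rank-≤ : ∀ (π : NC n) → rank π ≤ n
  rank-≤ π = ≤-trans (rank-antitone discrete π (discrete-⊑ π)) (≤-reflexive rank-discrete)

  rank-over-one : ∀ (π : NC n) → rank π ≡ rank π ∸ 1 + rank one
  rank-over-one π = trans (sym (m∸n+n≡m (rank-positive π))) (cong (λ r → rank π ∸ 1 + r) (sym rank-one))

  rank-under-discrete : ∀ (π : NC n) → rank discrete ≡ n ∸ rank π + rank π
  rank-under-discrete π = trans rank-discrete (sym (m∸n+n≡m (rank-≤ π)))

  Saturated : NC n → ℕ → ℕ → Set
  Saturated π p q = ∀ {a b} → a < n → b < n → cls π a ≡ cls π b → window p q a ≡ true → window p q b ≡ true

  module _ (p q : ℕ) (p<q : p < q) (q<n : q < n) where

    twoBlocks : NC n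
    twoBlocks = kernel _≟ᵇ_ (window p q) (window-nonCrossing n p q)

    ⊑-twoBlocks : ∀ (π : NC n) → Saturated π p q → π ⊑ twoBlocks
    ⊑-twoBlocks π sat {a} {b} a<n b<n a∼b = kernel⁺ _≟ᵇ_ _ (window-nonCrossing n p q) a<n b<n same
      where
      same : window p q a ≡ window p q b
      same with window p q a in wa | window p q b in wb
      ... | true  | true  = refl
      ... | false | false = refl
      ... | true  | false = trans (sym (sat a<n b<n a∼b wa)) wb
      ... | false | true  = trans (sym wa) (sat b<n a<n (sym a∼b) wb)

    -- One block minimum is 0. The other is q if the window starts at 0, and p otherwise.
    rank-twoBlocks : 2 ≤ rank twoBlocks
    rank-twoBlocks = two-firsts
      where
      first⁺ : ∀ {a} → a < n → First (window p q) a → does (clsFirst? twoBlocks a) ≡ true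
      first⁺ {a} a<n first = dec-true (clsFirst? twoBlocks a) λ b b<a b∼a →
        first b b<a (kernel⁻ _≟ᵇ_ _ (window-nonCrossing n p q) (<-trans b<a a<n) a<n b∼a)
      two : ∀ c → 0 < c → c < n → First (window p q) c → 2 ≤ rank twoBlocks
      two c 0<c c<n first = cnt-two (λ a → does (clsFirst? twoBlocks a)) 0<c c<n
        (first⁺ {0} (s≤s z≤n) λ _ ()) (first⁺ {c} c<n first)
      two-firsts : 2 ≤ rank twoBlocks
      two-firsts with p ≟ 0
      ... | yes p≡0 = two q (≤-<-trans z≤n p<q) q<n λ b b<q eq →
        case trans (sym (window-true p q b (≤-trans (≤-reflexive p≡0) z≤n) b<q)) (trans eq (window-false p q q λ (_ , q<q) → <-irrefl refl q<q)) of λ ()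
      ... | no p≢0 = two p (n≢0⇒n>0 p≢0) (<-trans p<q q<n) λ b b<p eq →
        case trans (sym (window-true p q p ≤-refl p<q)) (trans (sym eq) (window-false p q b λ (p≤b , _) → <⇒≱ b<p p≤b)) of λ ()

-- Distance and the tree condition

module _ {m : ℕ} where

  private
    n = suc m

  Respects : NC n → {X : Set} → (ℕ → X) → Set
  Respects π e = ∀ {a b} → a < n → b < n → cls π a ≡ cls π b → e a ≡ e b

  Onto : ∀ {k} → (ℕ → Fin k) → Set
  Onto {k} e = ∀ v → ∃[ a ] a < n × e a ≡ v

  merge : ∀ {k} {v w : Fin (suc k)} → w ≢ v → Fin (suc k) → Fin k
  merge {w = w} w≢v x with w Fin.≟ x
  ... | yes _   = punchOut w≢v
  ... | no w≢x = punchOut w≢x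

  merge-identifies : ∀ {k} {v w : Fin (suc k)} (w≢v : w ≢ v) → merge w≢v w ≡ merge w≢v v
  merge-identifies {v = v} {w} w≢v with w Fin.≟ w | w Fin.≟ v
  ... | no w≢w | _       = contradiction refl w≢w
  ... | _      | yes w≡v = contradiction w≡v w≢v
  ... | yes _  | no _    = Fin.punchOut-cong w refl

  merge-punchIn : ∀ {k} {v w : Fin (suc k)} (w≢v : w ≢ v) y → merge w≢v (punchIn w y) ≡ y
  merge-punchIn {w = w} w≢v y with w Fin.≟ punchIn w y
  ... | yes eq = contradiction (sym eq) (Fin.punchInᵢ≢i w y)
  ... | no _   = trans (Fin.punchOut-cong w refl) (Fin.punchOut-punchIn w)

  -- Going up along an edge merges at most two labels and going down none.
  coarsen : ∀ {l k} (π ρ : NC n) → Walk l π ρ → (e : ℕ → Fin k) → Onto e → Respects π e →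
    ∃[ k′ ] Σ[ e′ ∈ (ℕ → Fin k′) ] Onto e′ × Respects ρ e′ ×
      (∀ {a b} → e a ≡ e b → e′ a ≡ e′ b) × 2 * k + rank ρ ≤ 2 * k′ + l + rank π
  -- The bound says that k - k′ is at most the number u of steps up, without mentioning u: every
  -- step changes the rank by one, so 2 u = l + `rank π` - `rank ρ`.
  coarsen {k = k} π ρ (nil π≈ρ) e onto resp = k , e , onto ,
    (λ a<n b<n a∼b → resp a<n b<n (≈⇒⊑ ρ π (λ i → sym (π≈ρ i)) a<n b<n a∼b)) , id ,
    ≤-reflexive (cong₂ _+_ (sym (+-identityʳ (2 * k))) (sym (rank-≈ π ρ π≈ρ)))
  coarsen {suc l} {k} π ρ (cons {σ = σ} (inj₂ σ⋖π@((σ≼π , _) , _)) w) e onto resp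
    with coarsen σ ρ w e onto (λ a<n b<n a∼b → resp a<n b<n (≼⇒⊑ σ π σ≼π a<n b<n a∼b)) | ⋖⇒Split σ π σ⋖π
  ... | k′ , e′ , onto′ , resp′ , coarser , bound | _ , s , σ≈middle = k′ , e′ , onto′ , resp′ , coarser ,
    ≤-trans bound (≤-reflexive (trans
      (cong (λ r → 2 * k′ + l + r) (trans (rank-≈ σ (Split.middle s) σ≈middle) (Split.rank-middle s)))
      (shift (2 * k′) l (rank π))))
    where
    shift : ∀ x y z → x + y + (1 + z) ≡ x + (1 + y) + z
    shift = solve-∀
  coarsen {suc l} {k} π ρ (cons {σ = σ} (inj₁ π⋖σ) w) e onto resp with ⋖⇒Split π σ π⋖σ
  ... | j , s , π≈middle = go k e onto resp
    where
    open Split s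
    rank-π : rank π ≡ suc (rank σ)
    rank-π = trans (rank-≈ π middle π≈middle) rank-middle
    respects-σ : ∀ {k} (e : ℕ → Fin k) → Respects π e → e j ≡ e other → Respects σ e
    respects-σ e resp j∼other {a} {b} a<n b<n a∼b with two-parts a<n b<n a∼b
    ... | inj₁ ab               = resp a<n b<n (back ab)
      where
      back = λ p → ≈⇒⊑ middle π (λ i → sym (π≈middle i)) a<n b<n p
    ... | inj₂ (inj₁ (aj , bt)) = trans (resp a<n j<n (≈⇒⊑ middle π (λ i → sym (π≈middle i)) a<n j<n aj))
      (trans j∼other (sym (resp b<n other<n (≈⇒⊑ middle π (λ i → sym (π≈middle i)) b<n other<n bt))))
    ... | inj₂ (inj₂ (at , bj)) = trans (resp a<n other<n (≈⇒⊑ middle π (λ i → sym (π≈middle i)) a<n other<n at))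
      (trans (sym j∼other) (sym (resp b<n j<n (≈⇒⊑ middle π (λ i → sym (π≈middle i)) b<n j<n bj))))
    Goal : ℕ → ∀ {k} → (ℕ → Fin k) → Set
    Goal x {k} e = ∃[ k′ ] Σ[ e′ ∈ (ℕ → Fin k′) ] Onto e′ × Respects ρ e′ ×
      (∀ {a b} → e a ≡ e b → e′ a ≡ e′ b) × 2 * k + rank ρ ≤ 2 * k′ + x
    recurse : ∀ {k} (e : ℕ → Fin k) → Onto e → Respects σ e → Goal (l + rank σ) e
    recurse {k} e onto resp with coarsen σ ρ w e onto resp
    ... | k′ , e′ , onto′ , resp′ , coarser , bound = k′ , e′ , onto′ , resp′ , coarser ,
      ≤-trans bound (≤-reflexive (+-assoc (2 * k′) l (rank σ)))
    adjust : ∀ x y z → x + (2 + (y + z)) ≡ x + (1 + y) + (1 + z)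
    adjust = solve-∀
    finish : ∀ {k} (e : ℕ → Fin k) → Goal (2 + (l + rank σ)) e →
      ∃[ k′ ] Σ[ e′ ∈ (ℕ → Fin k′) ] Onto e′ × Respects ρ e′ ×
        (∀ {a b} → e a ≡ e b → e′ a ≡ e′ b) × 2 * k + rank ρ ≤ 2 * k′ + suc l + rank π
    finish e (k′ , e′ , onto′ , resp′ , coarser , bound) = k′ , e′ , onto′ , (λ a<n b<n → resp′ a<n b<n) , coarser ,
      ≤-trans bound (≤-reflexive (trans (adjust (2 * k′) l (rank σ)) (cong (λ r → 2 * k′ + suc l + r) (sym rank-π))))
    go : ∀ k (e : ℕ → Fin k) → Onto e → Respects π e →
      ∃[ k′ ] Σ[ e′ ∈ (ℕ → Fin k′) ] Onto e′ × Respects ρ e′ ×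
        (∀ {a b} → e a ≡ e b → e′ a ≡ e′ b) × 2 * k + rank ρ ≤ 2 * k′ + suc l + rank π
    go zero    e onto resp = case e j of λ ()
    go (suc k) e onto resp with e j Fin.≟ e other
    ... | yes j∼other with recurse e onto (respects-σ e resp j∼other)
    ...   | k′ , e′ , onto′ , resp′ , coarser , bound = finish e (k′ , e′ , onto′ , (λ a<n b<n → resp′ a<n b<n) , coarser ,
      ≤-trans bound (+-monoʳ-≤ (2 * k′) (m≤n+m _ 2)))
    go (suc k) e onto resp | no j≁other with recurse (merge j≁other ∘ e)
        (λ v → let a , a<n , eq = onto (punchIn (e j) v) in
          a , a<n , trans (cong (merge j≁other) eq) (merge-punchIn j≁other v))
        (respects-σ (merge j≁other ∘ e) (λ a<n b<n a∼b → cong (merge j≁other) (resp a<n b<n a∼b)) (merge-identifies j≁other))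
    ...   | k′ , e′ , onto′ , resp′ , coarser , bound = finish e (k′ , e′ , onto′ , (λ a<n b<n → resp′ a<n b<n) , coarser ∘ cong (merge j≁other) ,
      ≤-trans (≤-reflexive (double k (rank ρ))) (≤-trans (+-monoʳ-≤ 2 bound) (≤-reflexive (move-2 (2 * k′) (l + rank σ)))))
      where
      double : ∀ k r → 2 * (1 + k) + r ≡ 2 + (2 * k + r)
      double = solve-∀
      move-2 : ∀ x y → 2 + (x + y) ≡ x + (2 + y)
      move-2 = solve-∀

  -- The join in the lattice of all partitions is 1, or the bipartite graph of blocks is connected,
  -- expressed by labellings instead of paths.
  Connected : NC n → NC n → Set
  Connected π ρ = ∀ (e : ℕ → ℕ) → Respects π e → Respects ρ e → ∀ {a b} → a < n → b < n → e a ≡ e b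

  -- Coarsening the identity labelling along a chain from `discrete` up to π leaves at least
  -- `rank π` labels. Coarsening the result along the given walk yields a labelling constant on the
  -- blocks of both π and ρ, hence at most one label, and the bound of `coarsen` then gives the
  -- length.
  walk-length-≥ : ∀ {l} (π ρ : NC n) → Connected π ρ → Walk l π ρ → rank π + rank ρ ≤ 2 + l
  walk-length-≥ {l} π ρ connected w
    with coarsen discrete π
           (ascend (n ∸ rank π) discrete π π (discrete-⊑ π) (rank-under-discrete π) (nil λ _ → refl))
           clamp (λ v → toℕ v , Fin.toℕ<n v , clamp-toℕ v)
           (λ a<n b<n a∼b → cong clamp (discrete⁻ a<n b<n a∼b))
  ... | k₁ , e₁ , onto₁ , resp₁ , _ , bound₁ with coarsen π ρ w e₁ onto₁ (λ a<n b<n → resp₁ a<n b<n)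
  ...   | k₂ , e₂ , onto₂ , resp₂ , coarser , bound₂ =
    +-cancelˡ-≤ (rank π) _ _ (begin
      rank π + (rank π + rank ρ)   ≡⟨ double (rank π) (rank ρ) ⟩
      2 * rank π + rank ρ          ≤⟨ +-monoˡ-≤ (rank ρ) (*-monoʳ-≤ 2 rank≤k₁) ⟩
      2 * k₁ + rank ρ              ≤⟨ bound₂ ⟩
      2 * k₂ + l + rank π          ≤⟨ +-monoˡ-≤ (rank π) (+-monoˡ-≤ l (*-monoʳ-≤ 2 k₂≤1)) ⟩
      2 + l + rank π               ≡⟨ +-comm (2 + l) (rank π) ⟩
      rank π + (2 + l)             ∎)
    where
    open ≤-Reasoning
    double : ∀ x y → x + (x + y) ≡ 2 * x + y
    double = solve-∀
    k₂≤1 : k₂ ≤ 1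
    k₂≤1 = ≮⇒≥ λ 1<k₂ →
      let a , a<n , ea = onto₂ (fromℕ< (<-trans (s≤s z≤n) 1<k₂))
          b , b<n , eb = onto₂ (fromℕ< 1<k₂)
          same = connected (toℕ ∘ e₂)
            (λ x<n y<n x∼y → cong toℕ (coarser (resp₁ x<n y<n x∼y)))
            (λ x<n y<n x∼y → cong toℕ (resp₂ x<n y<n x∼y)) a<n b<n
      in case trans (sym (Fin.toℕ-fromℕ< _)) (trans (cong toℕ (sym ea)) (trans same (trans (cong toℕ eb) (Fin.toℕ-fromℕ< 1<k₂)))) of λ ()
    rank≤k₁ : rank π ≤ k₁
    rank≤k₁ = *-cancelˡ-≤ 2 (+-cancelˡ-≤ (2 * (n ∸ rank π)) _ _ (begin
      2 * (n ∸ rank π) + 2 * rank π                ≡⟨ *-distribˡ-+ 2 (n ∸ rank π) (rank π) ⟨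
      2 * (n ∸ rank π + rank π)                    ≡⟨ cong (2 *_) (m∸n+n≡m (rank-≤ π)) ⟩
      2 * n                                        ≤⟨ +-cancelʳ-≤ (rank π) _ _ (begin
        2 * n + rank π                                           ≤⟨ bound₁ ⟩
        2 * k₁ + (n ∸ rank π + 0) + rank {m} discrete            ≡⟨ cong (λ r → 2 * k₁ + (n ∸ rank π + 0) + r) (rank-under-discrete π) ⟩
        2 * k₁ + (n ∸ rank π + 0) + (n ∸ rank π + rank π)        ≡⟨ regroup (2 * k₁) (n ∸ rank π) (rank π) ⟩
        2 * (n ∸ rank π) + 2 * k₁ + rank π                       ∎) ⟩
      2 * (n ∸ rank π) + 2 * k₁                    ∎))
      where
      regroup : ∀ x y z → x + (y + 0) + (y + z) ≡ 2 * y + x + z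
      regroup = solve-∀

  distance-intro : ∀ (π ρ : NC n) → rank π + rank ρ ≡ suc n → Connected π ρ → d-H[ π , ρ ]≡ m
  distance-intro π ρ ranks connected =
    subst (λ l → Walk l π ρ) length
      (walk-above x y π ρ one (⊑-one π) (⊑-one ρ) (rank-over-one π) (rank-over-one ρ)) ,
    λ l w → +-cancelˡ-≤ 2 _ _ (≤-trans (≤-reflexive (sym ranks)) (walk-length-≥ π ρ connected w))
    where
    x = rank π ∸ 1
    y = rank ρ ∸ 1
    length : x + (y + 0) ≡ m
    length = +-cancelˡ-≡ 2 _ _ (trans (regroup x y)
      (trans (cong₂ _+_ (m∸n+n≡m (rank-positive π)) (m∸n+n≡m (rank-positive ρ))) ranks))
      where
      regroup : ∀ x y → 2 + (x + (y + 0)) ≡ (x + 1) + (y + 1)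
      regroup = solve-∀

  module _ (π ρ : NC n) (shortest : ∀ l → Walk l π ρ → m ≤ l) where

    ranks-≥ : suc n ≤ rank π + rank ρ
    ranks-≥ = begin
      2 + m                                  ≤⟨ +-monoʳ-≤ 2 (shortest _ (walk-above (rank π ∸ 1) (rank ρ ∸ 1) π ρ one (⊑-one π) (⊑-one ρ) (rank-over-one π) (rank-over-one ρ))) ⟩
      2 + (rank π ∸ 1 + (rank ρ ∸ 1 + 0))    ≡⟨ regroup (rank π ∸ 1) (rank ρ ∸ 1) ⟩
      (rank π ∸ 1 + 1) + (rank ρ ∸ 1 + 1)    ≡⟨ cong₂ _+_ (m∸n+n≡m (rank-positive π)) (m∸n+n≡m (rank-positive ρ)) ⟩
      rank π + rank ρ                        ∎
      where
      open ≤-Reasoning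
      regroup : ∀ x y → 2 + (x + (y + 0)) ≡ (x + 1) + (y + 1)
      regroup = solve-∀

    ranks-≤ : rank π + rank ρ ≤ suc n
    ranks-≤ = +-cancelʳ-≤ m _ _ (begin
      rank π + rank ρ + m                                          ≤⟨ +-monoʳ-≤ (rank π + rank ρ) (shortest _ (walk-below (n ∸ rank π) (n ∸ rank ρ) π ρ discrete (discrete-⊑ π) (discrete-⊑ ρ) (rank-under-discrete π) (rank-under-discrete ρ))) ⟩
      rank π + rank ρ + (n ∸ rank π + (n ∸ rank ρ + 0))            ≡⟨ regroup (rank π) (rank ρ) (n ∸ rank π) (n ∸ rank ρ) ⟩
      (n ∸ rank π + rank π) + (n ∸ rank ρ + rank ρ)                ≡⟨ cong₂ _+_ (m∸n+n≡m (rank-≤ π)) (m∸n+n≡m (rank-≤ ρ)) ⟩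
      n + n                                                        ≡⟨ +-suc n m ⟩
      suc n + m                                                    ∎)
      where
      open ≤-Reasoning
      regroup : ∀ x y z t → x + y + (z + (t + 0)) ≡ (z + x) + (t + y)
      regroup = solve-∀

    -- An interval saturated for both partitions would give a shorter walk, through a
    -- partition with two blocks above both.
    no-saturated-window : ∀ p q → p < q → q < n → Saturated π p q → Saturated ρ p q → ⊥
    no-saturated-window p q p<q q<n sat-π sat-ρ = 1+n≰n (begin
      3 + m                                            ≤⟨ ≤-reflexive (+-comm 3 m) ⟩
      m + 3                                            ≤⟨ +-mono-≤ (shortest _ (walk-above (rank π ∸ rank τ) (rank ρ ∸ rank τ) π ρ τ π⊑τ ρ⊑τ (over π π⊑τ) (over ρ ρ⊑τ)))
                                                            (≤-trans (n≤1+n 3) (+-mono-≤ 2≤rank 2≤rank)) ⟩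
      rank π ∸ rank τ + (rank ρ ∸ rank τ + 0) + (rank τ + rank τ)
                                                       ≡⟨ regroup (rank π ∸ rank τ) (rank ρ ∸ rank τ) (rank τ) ⟩
      (rank π ∸ rank τ + rank τ) + (rank ρ ∸ rank τ + rank τ)
                                                       ≡⟨ cong₂ _+_ (over π π⊑τ) (over ρ ρ⊑τ) ⟨
      rank π + rank ρ                                  ≤⟨ ranks-≤ ⟩
      2 + m                                            ∎)
      where
      open ≤-Reasoning
      τ : NC n
      τ = twoBlocks p q p<q q<n
      2≤rank : 2 ≤ rank τ
      2≤rank = rank-twoBlocks p q p<q q<n
      π⊑τ : π ⊑ τ
      π⊑τ = ⊑-twoBlocks p q p<q q<n π (λ a<n b<n → sat-π a<n b<n)
      ρ⊑τ : ρ ⊑ τ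
      ρ⊑τ = ⊑-twoBlocks p q p<q q<n ρ (λ a<n b<n → sat-ρ a<n b<n)
      over : ∀ (σ : NC n) → σ ⊑ τ → rank σ ≡ rank σ ∸ rank τ + rank τ
      over σ σ⊑τ = sym (m∸n+n≡m (rank-antitone σ τ σ⊑τ))
      regroup : ∀ x y z → x + (y + 0) + (z + z) ≡ (x + z) + (y + z)
      regroup = solve-∀

-- Runs of the automaton and Euler's formula

Stack : Set
Stack = List (ℕ × Mode)

Open : ℕ → Stack → Set
Open t = Any (λ x → proj₁ x ≡ t)

Descending : ℕ → Stack → Set
Descending b []              = ⊤
Descending b ((t , _) ∷ stk) = t < b × Descending t stk

Descending-mono : ∀ {b c} stk → b ≤ c → Descending b stk → Descending c stk
Descending-mono []              b≤c _           = tt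
Descending-mono ((t , _) ∷ stk) b≤c (t<b , desc) = <-≤-trans t<b b≤c , desc

Open⇒< : ∀ {b t} stk → Descending b stk → Open t stk → t < b
Open⇒< ((t , _) ∷ stk) (t<b , _)    (here refl) = t<b
Open⇒< ((t , _) ∷ stk) (t<b , desc) (there o)   = <-trans (Open⇒< stk desc o) t<b

-- Names the block of the point i by its minimum: a point that does not open a block belongs to the
-- last open one.
label : ℕ → Bool → Stack → ℕ
label i true  stk             = i
label i false []              = i
label i false ((t , _) ∷ stk) = t

module _ (i : ℕ) (m : Mode) where

  Descending-move : ∀ f l stk → Descending i stk → Descending (suc i) (proj₂ (move i m f l stk))
  Descending-move true  true  stk             desc         = Descending-mono stk (n≤1+n i) desc
  Descending-move true  false stk             desc         = ≤-refl , desc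
  Descending-move false false stk             desc         = Descending-mono stk (n≤1+n i) desc
  Descending-move false true  []              desc         = tt
  Descending-move false true  ((t , _) ∷ stk) (t<i , desc) = Descending-mono stk (<⇒≤ (m≤n⇒m≤1+n t<i)) desc

  Open-move⁻ : ∀ f l stk {t} → Open t (proj₂ (move i m f l stk)) → (t ≡ i × f ≡ true) ⊎ Open t stk
  Open-move⁻ true  true  stk       o           = inj₂ o
  Open-move⁻ true  false stk       (here refl) = inj₁ (refl , refl)
  Open-move⁻ true  false stk       (there o)   = inj₂ o
  Open-move⁻ false false stk       o           = inj₂ o
  Open-move⁻ false true  (x ∷ stk) o           = inj₂ (there o)

  Open-move : ∀ f l stk {t} → Open t stk → Open t (proj₂ (move i m f l stk)) ⊎ label i f stk ≡ t
  Open-move true  true  stk       o         = inj₁ o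
  Open-move true  false stk       o         = inj₁ (there o)
  Open-move false false stk       o         = inj₁ o
  Open-move false true  (x ∷ stk) (here eq) = inj₂ eq
  Open-move false true  (x ∷ stk) (there o) = inj₁ o

  label-closes : ∀ f stk → Descending i stk → ¬ Open (label i f stk) (proj₂ (move i m f true stk))
  label-closes true  stk             desc       o = <-irrefl refl (Open⇒< stk desc o)
  label-closes false ((t , _) ∷ stk) (_ , desc) o = <-irrefl refl (Open⇒< stk desc o)

  label-stays : ∀ f stk → (f ≡ false → ∃[ t ] Open t stk) → Open (label i f stk) (proj₂ (move i m f false stk))
  label-stays true  stk       _        = here refl
  label-stays false []        nonEmpty = case nonEmpty refl of λ ()
  label-stays false (x ∷ stk) _        = here refl

  label-open : ∀ stk → ∃[ t ] Open t stk → Open (label i false stk) stk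
  label-open (x ∷ stk) _ = here refl

  label-max : ∀ stk → Descending i stk → ∀ {t} → Open t stk → t ≤ label i false stk
  label-max ((t , _) ∷ stk) _          (here refl) = ≤-refl
  label-max ((t , _) ∷ stk) (_ , desc) (there o)   = <⇒≤ (Open⇒< stk desc o)

bit : Bool → ℕ
bit b = if b then 1 else 0

isFloating : Mode → Bool
isFloating floating = true
isFloating attached = false

floats : Stack → ℕ
floats []              = 0
floats ((_ , k) ∷ stk) = bit (isFloating k) + floats stk

-- The number of components of the graph read so far, provided none has been cut off. A block opened
-- in attached mode is connected to the open block below it, so each component with open blocks has
-- exactly one entry stored as floating; a floating current interval adds one further component.
weight : State → ℕ
weight (m , stk) = bit (isFloating m) + floats stk

closesCycle : Letter → State → Bool
closesCycle (s , f , l) (m , stk) = not (isFloating (join m s)) ∧ not f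

weight-move : ∀ i m f l stk → (f ≡ false → ∃[ t ] Open t stk) →
  bit f + bit (not (isFloating m) ∧ not f) + weight (m , stk) ≡ suc (weight (move i m f l stk))
weight-move i floating true  true  stk _ = refl
weight-move i attached true  true  stk _ = refl
weight-move i floating true  false stk _ = refl
weight-move i attached true  false stk _ = refl
weight-move i floating false l     []  nonEmpty = case nonEmpty refl of λ ()
weight-move i attached false l     []  nonEmpty = case nonEmpty refl of λ ()
weight-move i floating false false (x ∷ stk) _ = refl
weight-move i floating false true  (x ∷ stk) _ = refl
weight-move i attached false false (x ∷ stk) _ = refl
weight-move i attached false true  (x ∷ stk) _ = refl

weight-join : ∀ m s stk → separates m s ≡ true → bit s + weight (m , stk) ≡ weight (join m s , stk)
weight-join attached true  stk     _ = refl
weight-join attached false stk     _ = refl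
weight-join floating false stk     _ = refl

run : (ℕ → Letter) → ℕ → State
run g zero    = floating , []
run g (suc i) = next i (g i) (run g i)

word : (ℕ → Letter) → ℕ → ∀ k → Vec Letter k
word g i zero    = []
word g i (suc k) = g i ∷ word g (suc i) k

word-injective : ∀ {g h} i k → word g i k ≡ word h i k → ∀ {j} → i ≤ j → j < i + k → g j ≡ h j
word-injective i zero    eq i≤j j<i = contradiction (<-≤-trans j<i (≤-reflexive (+-identityʳ i))) (≤⇒≯ i≤j)
word-injective {g} {h} i (suc k) eq {j} i≤j j<i+k with m≤n⇒m<n∨m≡n i≤j
... | inj₁ i<j  = word-injective (suc i) k (Vec.∷-injectiveʳ eq) i<j (<-≤-trans j<i+k (≤-reflexive (+-suc i k)))
... | inj₂ refl = Vec.∷-injectiveˡ eq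

word-cong : ∀ {g h} i k → (∀ {j} → i ≤ j → j < i + k → g j ≡ h j) → word g i k ≡ word h i k
word-cong i zero    g≡h = refl
word-cong i (suc k) g≡h = cong₂ _∷_ (g≡h ≤-refl (m<m+n i (s≤s z≤n)))
  (word-cong (suc i) k λ i<j j<1+i+k → g≡h (<⇒≤ i<j) (<-≤-trans j<1+i+k (≤-reflexive (sym (+-suc i k)))))

letters : ∀ {k} → Vec Letter k → ℕ → Letter
letters []      j       = false , false , false
letters (x ∷ w) zero    = x
letters (x ∷ w) (suc j) = letters w j

word-letters : ∀ {k} g i (w : Vec Letter k) → (∀ j → g (j + i) ≡ letters w j) → word g i k ≡ w
word-letters g i []      g≡w = refl
word-letters g i (x ∷ w) g≡w = cong₂ _∷_ (g≡w 0)
  (word-letters g (suc i) w λ j → trans (cong g (+-suc j i)) (g≡w (suc j)))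

∧-true⁻ : ∀ {a b} → a ∧ b ≡ true → a ≡ true × b ≡ true
∧-true⁻ {true} {true} _ = refl , refl

accepts-intro : ∀ g i k → (∀ {j} → i ≤ j → j < i + k → legal (g j) (run g j) ≡ true) →
                run g (i + k) ≡ (floating , []) → accepts i (run g i) (word g i k) ≡ true
accepts-intro g i zero    _       final rewrite +-identityʳ i | final = refl
accepts-intro g i (suc k) all-legal final rewrite all-legal {i} ≤-refl (m<m+n i (s≤s z≤n)) =
  accepts-intro g (suc i) k
    (λ i<j j<1+i+k → all-legal (<⇒≤ i<j) (<-≤-trans j<1+i+k (≤-reflexive (sym (+-suc i k)))))
    (trans (cong (run g) (sym (+-suc i k))) final)

accepts-elim : ∀ g i k → accepts i (run g i) (word g i k) ≡ true →
               (∀ {j} → i ≤ j → j < i + k → legal (g j) (run g j) ≡ true) × run g (i + k) ≡ (floating , [])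
accepts-elim g i zero    acc rewrite +-identityʳ i =
  (λ i≤j j<i → contradiction j<i (≤⇒≯ i≤j)) , accepts-nil (run g i) acc
  where
  accepts-nil : ∀ σ → accepts i σ [] ≡ true → σ ≡ (floating , [])
  accepts-nil (floating , []) _ = refl
accepts-elim g i (suc k) acc rewrite +-suc i k with ∧-true⁻ acc
... | legal-i , acc′ with accepts-elim g (suc i) k acc′
...   | legal-later , final = legal-all , final
  where
  legal-all : ∀ {j} → i ≤ j → j < suc (i + k) → legal (g j) (run g j) ≡ true
  legal-all i≤j j< with m≤n⇒m<n∨m≡n i≤j
  ... | inj₁ i<j  = legal-later i<j j<
  ... | inj₂ refl = legal-i

¬true : ∀ {b} → b ≢ true → b ≡ false
¬true {false} _     = refl
¬true {true}  b≢true = contradiction refl b≢true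

module Run (g : ℕ → Letter) where

  S F E : ℕ → Bool
  S i = proj₁ (g i)
  F i = proj₁ (proj₂ (g i))
  E i = proj₂ (proj₂ (g i))

  mode : ℕ → Mode
  mode i = proj₁ (run g i)

  stk : ℕ → Stack
  stk i = proj₂ (run g i)

  joined : ℕ → Mode
  joined i = join (mode i) (S i)

  lab : ℕ → ℕ
  lab i = label i (F i) (stk i)

  cyc : ℕ → Bool
  cyc i = closesCycle (g i) (run g i)

  HasOpen : ℕ → Set
  HasOpen i = F i ≡ false → ∃[ t ] Open t (stk i)

  descending : ∀ i → Descending i (stk i)
  descending zero    = tt
  descending (suc i) = Descending-move i (joined i) (F i) (E i) (stk i) (descending i)

  Open-< : ∀ i {t} → Open t (stk i) → t < i
  Open-< i = Open⇒< (stk i) (descending i)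

  Open-suc⁻ : ∀ i {t} → Open t (stk (suc i)) → (t ≡ i × F i ≡ true) ⊎ Open t (stk i)
  Open-suc⁻ i = Open-move⁻ i (joined i) (F i) (E i) (stk i)

  Open-suc : ∀ i {t} → Open t (stk i) → Open t (stk (suc i)) ⊎ lab i ≡ t
  Open-suc i = Open-move i (joined i) (F i) (E i) (stk i)

  closes : ∀ i → E i ≡ true → ¬ Open (lab i) (stk (suc i))
  closes i eq o = label-closes i (joined i) (F i) (stk i) (descending i)
    (subst (λ l → Open (lab i) (proj₂ (move i (joined i) (F i) l (stk i)))) eq o)

  stays : ∀ i → HasOpen i → E i ≡ false → Open (lab i) (stk (suc i))
  stays i hasOpen eq = subst (λ l → Open (lab i) (proj₂ (move i (joined i) (F i) l (stk i)))) (sym eq)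
    (label-stays i (joined i) (F i) (stk i) hasOpen)

  lab-first : ∀ i → F i ≡ true → lab i ≡ i
  lab-first i eq = cong (λ f → label i f (stk i)) eq

  lab-open : ∀ i → HasOpen i → F i ≡ false → Open (lab i) (stk i)
  lab-open i hasOpen eq = subst (λ f → Open (label i f (stk i)) (stk i)) (sym eq)
    (label-open i attached (stk i) (hasOpen eq))

  lab-max : ∀ i → F i ≡ false → ∀ {t} → Open t (stk i) → t ≤ lab i
  lab-max i eq {t} o = subst (λ f → t ≤ label i f (stk i)) (sym eq) (label-max i attached (stk i) (descending i) o)

  cyc-false : ∀ i → F i ≡ false → cyc i ≡ false → joined i ≡ floating
  cyc-false i eq c with F i | joined i
  ... | false | floating = refl

  -- Euler's formula: vertices plus independent cycles equal edges plus components. The vertices are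
  -- the top intervals and the bottom blocks, the edges are the points, and the initial `suc` is the
  -- first interval, which has no start bit.
  weight-run : ∀ n → (∀ {j} → j < n → separates (mode j) (S j) ≡ true) → (∀ {j} → j < n → HasOpen j) →
    suc (cnt S n + cnt F n + cnt cyc n) ≡ n + weight (run g n)
  weight-run zero    _         _       = refl
  weight-run (suc n) separated hasOpen = begin
    suc (bit (S n) + cnt S n + (bit (F n) + cnt F n) + (bit (cyc n) + cnt cyc n))
      ≡⟨ regroup (bit (S n)) (bit (F n)) (bit (cyc n)) (cnt S n) (cnt F n) (cnt cyc n) ⟩
    bit (F n) + bit (cyc n) + (bit (S n) + suc (cnt S n + cnt F n + cnt cyc n))
      ≡⟨ cong (λ x → bit (F n) + bit (cyc n) + (bit (S n) + x)) (weight-run n (separated ∘ m≤n⇒m≤1+n) (hasOpen ∘ m≤n⇒m≤1+n)) ⟩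
    bit (F n) + bit (cyc n) + (bit (S n) + (n + weight (run g n)))
      ≡⟨ regroup′ (bit (F n)) (bit (cyc n)) (bit (S n)) n (weight (run g n)) ⟩
    n + (bit (F n) + bit (cyc n) + (bit (S n) + weight (run g n)))
      ≡⟨ cong (λ x → n + (bit (F n) + bit (cyc n) + x)) (weight-join (mode n) (S n) (stk n) (separated ≤-refl)) ⟩
    n + (bit (F n) + bit (cyc n) + weight (joined n , stk n))
      ≡⟨ cong (λ x → n + x) (weight-move n (joined n) (F n) (E n) (stk n) (hasOpen ≤-refl)) ⟩
    n + suc (weight (run g (suc n)))
      ≡⟨ +-suc n _ ⟩
    suc n + weight (run g (suc n)) ∎
    where
    open ≡-Reasoning
    regroup : ∀ a b c x y z → 1 + (a + x + (b + y) + (c + z)) ≡ b + c + (a + (1 + (x + y + z)))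
    regroup = solve-∀
    regroup′ : ∀ a b c x y → a + b + (c + (x + y)) ≡ x + (a + b + (c + y))
    regroup′ = solve-∀

-- The letters of a pair of partitions

module _ {m : ℕ} where

  private
    n = suc m

  clsLast? : ∀ (π : NC n) a → Dec (Last n (cls π) a)
  clsLast? π = last? _≟ˢ_ n (cls π)

  module _ {X : Set} (_≟ˣ_ : DecidableEquality X) (e : ℕ → X) (nc : NonCrossingOn n e) {a : ℕ} (a<n : a < n) where

    kernel-First : First e a ⇔ First (cls (kernel _≟ˣ_ e nc)) a
    kernel-First = mk⇔
      (λ first b b<a b∼a → first b b<a (kernel⁻ _≟ˣ_ e nc (<-trans b<a a<n) a<n b∼a))
      (λ first b b<a b∼a → first b b<a (kernel⁺ _≟ˣ_ e nc (<-trans b<a a<n) a<n b∼a))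

    kernel-Last : Last n e a ⇔ Last n (cls (kernel _≟ˣ_ e nc)) a
    kernel-Last = mk⇔
      (λ last b b<n a<b b∼a → last b b<n a<b (kernel⁻ _≟ˣ_ e nc b<n a<n b∼a))
      (λ last b b<n a<b b∼a → last b b<n a<b (kernel⁺ _≟ˣ_ e nc b<n a<n b∼a))

  Convex : NC n → Set
  Convex π = ∀ {a b c} → a < b → b < c → c < n → cls π a ≡ cls π c → cls π a ≡ cls π b

  ∈⇒cls : ∀ (π : NC n) {i j} → j ∈ block (proj₁ π) i → cls π (toℕ j) ≡ cls π (toℕ i)
  ∈⇒cls π {i} {j} j∈ = trans (cls-toℕ π j) (trans (block-same (proj₁ π) j∈) (sym (cls-toℕ π i)))

  cls⇒∈ : ∀ (π : NC n) {i j} → cls π (toℕ j) ≡ cls π (toℕ i) → j ∈ block (proj₁ π) i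
  cls⇒∈ π {i} {j} eq = subst (j ∈_) (trans (sym (cls-toℕ π j)) (trans eq (cls-toℕ π i))) (block-self (proj₁ π) j)

  IsInterval⇒Convex : ∀ (π : NC n) → IsInterval π → Convex π
  IsInterval⇒Convex π interval {a} {b} {c} a<b b<c c<n a∼c with interval (block (proj₁ π) (clamp a)) (clamp a , refl)
  ... | p , q , p≤q , char = sym (block-same (proj₁ π)
    (Equivalence.from (char (clamp b))
      ( ≤-trans p≤a (subst₂ _≤_ (sym (toℕ-clamp a<n)) (sym (toℕ-clamp b<n)) (<⇒≤ a<b))
      , ≤-trans (subst₂ _≤_ (sym (toℕ-clamp b<n)) (sym (toℕ-clamp c<n)) (<⇒≤ b<c)) c≤q)))
    where
    b<n = <-trans b<c c<n
    a<n = <-trans a<b b<n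
    p≤a = proj₁ (Equivalence.to (char (clamp a)) (block-self (proj₁ π) (clamp a)))
    c≤q = proj₂ (Equivalence.to (char (clamp c)) (subst (clamp c ∈_) (sym a∼c) (block-self (proj₁ π) (clamp c))))

  Convex⇒IsInterval : ∀ (π : NC n) → Convex π → IsInterval π
  Convex⇒IsInterval π convex V (i , refl)
    with firstOf _≟ˢ_ (cls π) (toℕ i) | lastOf _≟ˢ_ n (cls π) (toℕ i) (Fin.toℕ<n i)
  ... | p , p≤i , first , p∼i | q , i≤q , q<n , last , q∼i =
    clamp p , clamp q , subst₂ _≤_ (sym (toℕ-clamp p<n)) (sym (toℕ-clamp q<n)) (≤-trans p≤i i≤q) ,
    λ j → mk⇔
      (λ j∈V → let j∼i = ∈⇒cls π j∈V in
        subst (_≤ toℕ j) (sym (toℕ-clamp p<n)) (≮⇒≥ λ j<p → first (toℕ j) j<p (trans j∼i (sym p∼i))) ,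
        subst (toℕ j ≤_) (sym (toℕ-clamp q<n)) (≮⇒≥ λ q<j → last (toℕ j) (Fin.toℕ<n j) q<j (trans j∼i (sym q∼i))))
      λ (p≤j , j≤q) → cls⇒∈ π (between (toℕ j) (subst (_≤ toℕ j) (toℕ-clamp p<n) p≤j) (subst (toℕ j ≤_) (toℕ-clamp q<n) j≤q))
    where
    p<n = ≤-<-trans p≤i (Fin.toℕ<n i)
    between : ∀ j → p ≤ j → j ≤ q → cls π j ≡ cls π (toℕ i)
    between j p≤j j≤q with m≤n⇒m<n∨m≡n p≤j | m≤n⇒m<n∨m≡n j≤q
    ... | inj₂ refl | _         = p∼i
    ... | _         | inj₂ refl = q∼i
    ... | inj₁ p<j  | inj₁ j<q  = trans (sym (convex p<j j<q q<n (trans p∼i (sym q∼i)))) p∼i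

  startBit : NC n → ℕ → Bool
  startBit π zero    = false
  startBit π (suc i) = not (does (cls π i ≟ˢ cls π (suc i)))

  letterOf : NC n → NC n → ℕ → Letter
  letterOf π ρ i = startBit π i , does (clsFirst? ρ i) , does (clsLast? ρ i)

  startBit-false : ∀ (π : NC n) i → startBit π (suc i) ≡ false → cls π i ≡ cls π (suc i)
  startBit-false π i eq with cls π i ≟ˢ cls π (suc i)
  ... | yes same = same

  startBit-true : ∀ (π : NC n) i → startBit π (suc i) ≡ true → cls π i ≢ cls π (suc i)
  startBit-true π i eq with cls π i ≟ˢ cls π (suc i)
  ... | no differ = differ

  startBit-≡ : ∀ (π : NC n) i → cls π i ≡ cls π (suc i) → startBit π (suc i) ≡ false
  startBit-≡ π i same = cong not (dec-true (cls π i ≟ˢ cls π (suc i)) same)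

  startBit-≢ : ∀ (π : NC n) i → cls π i ≢ cls π (suc i) → startBit π (suc i) ≡ true
  startBit-≢ π i differ = cong not (dec-false (cls π i ≟ˢ cls π (suc i)) differ)

  Convex-step : ∀ (π : NC n) → Convex π → ∀ {a i} → a ≤ i → suc i < n → cls π a ≡ cls π (suc i) → cls π i ≡ cls π (suc i)
  Convex-step π convex a≤i i<n a∼ with m≤n⇒m<n∨m≡n a≤i
  ... | inj₁ a<i  = trans (sym (convex a<i ≤-refl i<n a∼)) a∼
  ... | inj₂ refl = a∼

  rank-starts : ∀ (π : NC n) → Convex π → rank π ≡ suc (cnt (startBit π) n)
  rank-starts π convex = cnt-insert n (s≤s z≤n) (dec-true (clsFirst? π 0) λ _ ()) refl agree
    where
    agree : ∀ {a} → a < n → a ≢ 0 → does (clsFirst? π a) ≡ startBit π a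
    agree {zero}  _   0≢0 = contradiction refl 0≢0
    agree {suc i} i<n _   = by-cases (cls π i ≟ˢ cls π (suc i))
      where
      by-cases : Dec (cls π i ≡ cls π (suc i)) → does (clsFirst? π (suc i)) ≡ startBit π (suc i)
      by-cases (yes same)  = trans
        (dec-false (clsFirst? π (suc i)) λ first → first i ≤-refl same)
        (sym (startBit-≡ π i same))
      by-cases (no differ) = trans
        (dec-true (clsFirst? π (suc i)) λ b b<1+i b∼ → differ (Convex-step π convex (s≤s⁻¹ b<1+i) i<n b∼))
        (sym (startBit-≢ π i differ))

-- Decoding an accepted word

connects-open : ∀ m stk → connects m false stk ≡ true → ∃[ t ] Open t stk
connects-open floating ((t , _) ∷ _) _ = t , here refl

connects-no-cycle : ∀ m f stk → connects m f stk ≡ true → not (isFloating m) ∧ not f ≡ false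
connects-no-cycle attached true  stk _ = refl
connects-no-cycle floating true  stk _ = refl
connects-no-cycle floating false stk _ = refl

-- If e is constant on the blocks of both partitions, its value x at the current interval
-- is known to be that at the last open block of the component.
Linked : Mode → ℕ → (ℕ → ℕ) → Stack → Set
Linked floating x e stk             = ⊤
Linked attached x e []              = ⊥
Linked attached x e ((t , _) ∷ stk) = x ≡ e t

AllLinked : (ℕ → ℕ) → Stack → Set
AllLinked e []              = ⊤
AllLinked e ((t , k) ∷ stk) = Linked k (e t) e stk × AllLinked e stk

Linked-move : ∀ e i m f l stk → Linked m (e i) e stk → AllLinked e stk → e i ≡ e (label i f stk) →
  (f ≡ false → ∃[ t ] Open t stk) →
  let k , stk′ = move i m f l stk in Linked k (e i) e stk′ × AllLinked e stk′
Linked-move e i m true  true  stk             link all eq _        = link , all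
Linked-move e i m true  false stk             link all eq _        = refl , link , all
Linked-move e i m false l     []              link all eq nonEmpty = case nonEmpty refl of λ ()
Linked-move e i m false false (x ∷ stk)       link all eq _        = eq , all
Linked-move e i m false true  ((t , k) ∷ stk) link (link′ , all) eq _ =
  subst (λ x → Linked k x e stk) (sym eq) link′ , all

Linked-join : ∀ e m s {x y} stk → Linked m x e stk → (s ≡ false → x ≡ y) → Linked (join m s) y e stk
Linked-join e floating s     stk link x≡y = tt
Linked-join e attached true  stk link x≡y = tt
Linked-join e attached false ((t , _) ∷ stk) link x≡y = trans (sym (x≡y refl)) link

Linked-open : ∀ e m s {x} stk → separates m s ≡ true → s ≡ true → Linked m x e stk → ∃[ t ] Open t stk × x ≡ e t
Linked-open e attached true ((t , _) ∷ stk) _ _ link = t , here refl , link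

module Decode {m : ℕ} (g : ℕ → Letter)
  (legal-all : ∀ {j} → j < suc m → legal (g j) (run g j) ≡ true)
  (final : run g (suc m) ≡ (floating , [])) where

  open Run g

  private
    n = suc m

  separated : ∀ {j} → j < n → separates (mode j) (S j) ≡ true
  separated j<n = proj₁ (∧-true⁻ (legal-all j<n))

  connected : ∀ {j} → j < n → connects (joined j) (F j) (stk j) ≡ true
  connected j<n = proj₂ (∧-true⁻ (legal-all j<n))

  hasOpen : ∀ {j} → j < n → HasOpen j
  hasOpen {j} j<n eq = connects-open (joined j) (stk j)
    (subst (λ f → connects (joined j) f (stk j) ≡ true) eq (connected j<n))

  no-open-at-end : ∀ {t} → ¬ Open t (stk n)
  no-open-at-end o with subst (λ σ → Open _ (proj₂ σ)) final o
  ... | ()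

  open-lab : ∀ {i} → i ≤ n → ∀ {t} → Open t (stk i) → lab t ≡ t
  open-lab {suc i} i<n o with Open-suc⁻ i o
  ... | inj₁ (refl , first) = lab-first i first
  ... | inj₂ o′             = open-lab (<⇒≤ i<n) o′

  lab-≤ : ∀ {a} → a < n → lab a ≤ a × lab (lab a) ≡ lab a
  lab-≤ {a} a<n = by-cases (F a) refl
    where
    by-cases : ∀ f → F a ≡ f → lab a ≤ a × lab (lab a) ≡ lab a
    by-cases true  eq = ≤-reflexive (lab-first a eq) , cong lab (lab-first a eq)
    by-cases false eq = let o = lab-open a (hasOpen a<n) eq in <⇒≤ (Open-< a o) , open-lab (<⇒≤ a<n) o

  -- While t remains open, points read after a point of its block cannot reach the blocks below it
  -- on the stack; and the stack is descending.
  visible : ∀ {i} → i ≤ n → ∀ {t a b} → Open t (stk i) → a < b → b < i → lab a ≡ t → t ≤ lab b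
  visible {suc i} i<n {t} {a} {b} o a<b b<1+i a∼t with m≤n⇒m<n∨m≡n b<1+i | Open-suc⁻ i o
  ... | _          | inj₁ (refl , _) = contradiction (≤-<-trans (proj₁ (lab-≤ (<-trans a<i i<n))) a<i) (<⇒≱ (s≤s (≤-reflexive (sym a∼t))))
    where a<i = <-≤-trans a<b (s≤s⁻¹ b<1+i)
  ... | inj₁ b<i   | inj₂ o′ = visible (<⇒≤ i<n) o′ a<b (s≤s⁻¹ b<i) a∼t
  ... | inj₂ refl  | inj₂ o′ = by-cases (F i) refl
    where
    by-cases : ∀ f → F i ≡ f → t ≤ lab i
    by-cases true  eq = ≤-trans (<⇒≤ (Open-< i o′)) (≤-reflexive (sym (lab-first i eq)))
    by-cases false eq = lab-max i eq o′

  lab-nonCrossing : ∀ {i} → i ≤ n → NonCrossingOn i lab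
  lab-nonCrossing {suc i} i<n {a} {b} {c} {d} a<b b<c c<d d<1+i a∼c b∼d with m≤n⇒m<n∨m≡n d<1+i
  ... | inj₁ d<i  = lab-nonCrossing (<⇒≤ i<n) a<b b<c c<d (s≤s⁻¹ d<i) a∼c b∼d
  ... | inj₂ refl = by-cases (F i) refl
    where
    b<i = <-trans b<c c<d
    a<n = <-trans (<-trans a<b b<i) i<n
    by-cases : ∀ f → F i ≡ f → lab a ≡ lab b
    by-cases true  eq = contradiction (trans b∼d (lab-first i eq)) (<⇒≢ (≤-<-trans (proj₁ (lab-≤ (<-trans b<i i<n))) b<i))
    by-cases false eq = sym (≤-reflexive-or-crossing (m≤n⇒m<n∨m≡n t≤u))
      where
      o = lab-open i (hasOpen i<n) eq
      t≤u : lab b ≤ lab a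
      t≤u = ≤-trans (≤-reflexive b∼d) (≤-trans (visible (<⇒≤ i<n) o b<c c<d b∼d) (≤-reflexive (sym a∼c)))
      ≤-reflexive-or-crossing : lab b < lab a ⊎ lab b ≡ lab a → lab b ≡ lab a
      ≤-reflexive-or-crossing (inj₂ t≡u) = t≡u
      -- The minima t = `lab b` and u = `lab a` would give the crossing t < u < b < c among earlier
      -- points, so the induction hypothesis applies.
      ≤-reflexive-or-crossing (inj₁ t<u) =
        trans (sym (proj₂ (lab-≤ (<-trans b<i i<n)))) (trans
          (lab-nonCrossing (<⇒≤ i<n) t<u (≤-<-trans (proj₁ (lab-≤ a<n)) a<b) b<c c<d
            (proj₂ (lab-≤ (<-trans b<i i<n))) (trans (proj₂ (lab-≤ a<n)) a∼c))
          (proj₂ (lab-≤ a<n)))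

  -- Only the current position is ever pushed, so a smaller one that has left the stack cannot
  -- return.
  gone : ∀ {i j t} → i ≤ j → t < i → ¬ Open t (stk i) → ¬ Open t (stk j)
  gone {i} {j} i≤j t<i ¬o with m≤n⇒m<n∨m≡n i≤j
  ... | inj₂ refl = ¬o
  gone {i} {suc j} i≤j t<i ¬o | inj₁ i<1+j = λ o → case Open-suc⁻ j o of λ
    { (inj₁ (refl , _)) → <⇒≱ t<i (s≤s⁻¹ i<1+j)
    ; (inj₂ o′)         → gone (s≤s⁻¹ i<1+j) t<i ¬o o′ }

  closed-later : ∀ d {j t} → j + d ≡ n → Open t (stk j) → ∃[ b ] j ≤ b × b < n × lab b ≡ t
  closed-later zero    {j} eq   o rewrite sym (trans (sym eq) (+-identityʳ j)) = contradiction o no-open-at-end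
  closed-later (suc d) {j} eq o with Open-suc j o
  ... | inj₂ t≡ = j , ≤-refl , <-≤-trans (m<m+n j (s≤s z≤n)) (≤-reflexive eq) , t≡
  ... | inj₁ o′ = let b , j<b , rest = closed-later d (trans (sym (+-suc j d)) eq) o′ in b , <⇒≤ j<b , rest

  F-First : ∀ {a} → a < n → F a ≡ does (first? _≟_ lab a)
  F-First {a} a<n = by-cases (F a) refl
    where
    by-cases : ∀ f → F a ≡ f → F a ≡ does (first? _≟_ lab a)
    by-cases true  eq = trans eq (sym (dec-true (first? _≟_ lab a) λ b b<a b∼a →
      <⇒≢ (≤-<-trans (proj₁ (lab-≤ (<-trans b<a a<n))) b<a) (trans b∼a (lab-first a eq))))
    by-cases false eq = trans eq (sym (dec-false (first? _≟_ lab a) λ first →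
      first (lab a) (Open-< a (lab-open a (hasOpen a<n) eq)) (proj₂ (lab-≤ a<n))))

  E-Last : ∀ {a} → a < n → E a ≡ does (last? _≟_ n lab a)
  E-Last {a} a<n = by-cases (E a) refl
    where
    by-cases : ∀ l → E a ≡ l → E a ≡ does (last? _≟_ n lab a)
    by-cases true  eq = trans eq (sym (dec-true (last? _≟_ n lab a) λ b b<n a<b b∼a → later b b<n a<b b∼a (F b) refl))
      where
      later : ∀ b → b < n → a < b → lab b ≡ lab a → ∀ f → F b ≡ f → ⊥
      later b b<n a<b b∼a true  first = <⇒≢ (≤-<-trans (proj₁ (lab-≤ a<n)) a<b) (trans (sym b∼a) (lab-first b first))
      later b b<n a<b b∼a false first = gone a<b (s≤s (proj₁ (lab-≤ a<n))) (closes a eq)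
        (subst (λ t → Open t (stk b)) b∼a (lab-open b (hasOpen b<n) first))
    by-cases false eq = trans eq (sym (dec-false (last? _≟_ n lab a) λ last →
      let b , a<b , b<n , b∼a = closed-later (n ∸ suc a) (m+[n∸m]≡n a<n) (stays a (hasOpen a<n) eq)
      in last b b<n a<b b∼a))

  ρ : NC n
  ρ = kernel _≟_ lab (lab-nonCrossing ≤-refl)

  interval : ℕ → ℕ
  interval a = cnt S (suc a)

  interval-mono : ∀ {a b} → a ≤ b → interval a ≤ interval b
  interval-mono a≤b = cnt-≤ S (s≤s a≤b)

  interval-convex : ∀ {a b c} → a < b → b < c → interval a ≡ interval c → interval a ≡ interval b
  interval-convex a<b b<c a∼c = ≤-antisym (interval-mono (<⇒≤ a<b))
    (≤-trans (interval-mono (<⇒≤ b<c)) (≤-reflexive (sym a∼c)))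

  private
    interval-nonCrossing : NonCrossingOn n interval
    interval-nonCrossing a<b b<c _ _ a∼c _ = interval-convex a<b b<c a∼c

  π : NC n
  π = kernel _≟_ interval interval-nonCrossing

  π-Convex : Convex π
  π-Convex a<b b<c c<n a∼c = kernel⁺ _≟_ interval interval-nonCrossing a<n b<n
    (interval-convex a<b b<c (kernel⁻ _≟_ interval interval-nonCrossing a<n c<n a∼c))
    where
    b<n = <-trans b<c c<n
    a<n = <-trans a<b b<n

  S-start : ∀ {i} → i < n → startBit π i ≡ S i
  S-start {zero}  _     = sym (first-not-start (S 0) (separated (s≤s z≤n)))
    where
    first-not-start : ∀ s → separates floating s ≡ true → s ≡ false
    first-not-start false _ = refl
  S-start {suc i} 1+i<n = by-cases (S (suc i)) refl
    where
    i<n = <-trans ≤-refl 1+i<n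
    by-cases : ∀ s → S (suc i) ≡ s → startBit π (suc i) ≡ S (suc i)
    by-cases false eq = trans (startBit-≡ π i (kernel⁺ _≟_ interval interval-nonCrossing i<n 1+i<n
      (cong (λ b → bit b + interval i) (sym eq)))) (sym eq)
    by-cases true  eq = trans (startBit-≢ π i λ i∼1+i → 1+n≢n (trans
      (cong (λ b → bit b + interval i) (sym eq))
      (sym (kernel⁻ _≟_ interval interval-nonCrossing i<n 1+i<n i∼1+i)))) (sym eq)

  F-cls : ∀ {i} → i < n → does (clsFirst? ρ i) ≡ F i
  F-cls {i} i<n = sym (trans (F-First i<n)
    (does-⇔ (kernel-First _≟_ lab (lab-nonCrossing ≤-refl) i<n) (first? _≟_ lab i) (clsFirst? ρ i)))

  E-cls : ∀ {i} → i < n → does (clsLast? ρ i) ≡ E i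
  E-cls {i} i<n = sym (trans (E-Last i<n)
    (does-⇔ (kernel-Last _≟_ lab (lab-nonCrossing ≤-refl) i<n) (last? _≟_ n lab i) (clsLast? ρ i)))

  letterOf-decode : ∀ {i} → i < n → letterOf π ρ i ≡ g i
  letterOf-decode i<n = cong₂ _,_ (S-start i<n) (cong₂ _,_ (F-cls i<n) (E-cls i<n))

  ranks : rank π + rank ρ ≡ suc n
  ranks = begin
    rank π + rank ρ                              ≡⟨ cong₂ _+_ (trans (rank-starts π π-Convex) (cong suc (cnt-cong n S-start))) (cnt-cong n F-cls) ⟩
    suc (cnt S n) + cnt F n                      ≡⟨ +-identityʳ _ ⟨
    suc (cnt S n + cnt F n) + 0                  ≡⟨ cong (λ c → suc (cnt S n + cnt F n) + c) (sym no-cycles) ⟩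
    suc (cnt S n + cnt F n + cnt cyc n)          ≡⟨ weight-run n separated hasOpen ⟩
    n + weight (run g n)                         ≡⟨ cong (λ σ → n + weight σ) final ⟩
    n + 1                                        ≡⟨ +-comm n 1 ⟩
    suc n                                        ∎
    where
    open ≡-Reasoning
    all-false : ∀ {f} k → (∀ {j} → j < k → f j ≡ false) → cnt f k ≡ 0
    all-false zero    _   = refl
    all-false (suc k) eqs rewrite eqs {k} ≤-refl = all-false k (eqs ∘ m≤n⇒m≤1+n)
    no-cycles : cnt cyc n ≡ 0
    no-cycles = all-false n λ {j} j<n → connects-no-cycle (joined j) (F j) (stk j) (connected j<n)

  module _ (e : ℕ → ℕ) (resp-π : Respects π e) (resp-ρ : Respects ρ e) where

    e-lab : ∀ {i} → i < n → e i ≡ e (lab i)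
    e-lab i<n = resp-ρ i<n (≤-<-trans (proj₁ (lab-≤ i<n)) i<n)
      (kernel⁺ _≟_ lab (lab-nonCrossing ≤-refl) i<n (≤-<-trans (proj₁ (lab-≤ i<n)) i<n) (sym (proj₂ (lab-≤ i<n))))

    e-same : ∀ {i} → suc i < n → S (suc i) ≡ false → e i ≡ e (suc i)
    e-same {i} 1+i<n eq = resp-π (<-trans ≤-refl 1+i<n) 1+i<n
      (startBit-false π i (trans (S-start 1+i<n) eq))

    linked-joined : ∀ i → i < n → Linked (mode i) (e (pred i)) e (stk i) → Linked (joined i) (e i) e (stk i)
    linked-joined zero    i<n link = tt
    linked-joined (suc i) i<n link = Linked-join e (mode (suc i)) (S (suc i)) (stk (suc i)) link (e-same i<n)

    -- The current interval is represented by the last point read, `pred i`. At i = 0 the mode is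
    -- floating and nothing is claimed about it.
    linked : ∀ i → i ≤ n → Linked (mode i) (e (pred i)) e (stk i) × AllLinked e (stk i)
    linked zero    _   = tt , tt
    linked (suc i) i<n = let link , all = linked i (<⇒≤ i<n) in
      Linked-move e i (joined i) (F i) (E i) (stk i) (linked-joined i i<n link) all (e-lab i<n) (hasOpen i<n)

    -- No component is lost: an interval ends only while attached, which passes its value to an open
    -- block, and a block that closes passes its value to the current interval. At the end no block
    -- is open, so all points share the value of the last one.
    covered : ∀ i → i ≤ n → ∀ {j} → j < i → e j ≡ e (pred i) ⊎ (∃[ t ] Open t (stk i) × e j ≡ e t)
    covered (suc i) i<n {j} j<1+i with m≤n⇒m<n∨m≡n j<1+i
    ... | inj₂ refl = inj₁ refl
    ... | inj₁ j<i  = [ before i refl (s≤s⁻¹ j<i) i<n , via-open ]′ (covered i (<⇒≤ i<n) (s≤s⁻¹ j<i))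
      where
      Goal : Set
      Goal = e j ≡ e i ⊎ (∃[ t ] Open t (stk (suc i)) × e j ≡ e t)
      via-open : ∃[ t ] Open t (stk i) × e j ≡ e t → Goal
      via-open (t , o , j∼t) with Open-suc i o
      ... | inj₁ o′   = inj₂ (t , o′ , j∼t)
      ... | inj₂ refl = inj₁ (trans j∼t (sym (e-lab i<n)))
      before : ∀ i′ → i′ ≡ i → j < i′ → i′ < n → e j ≡ e (pred i) → Goal
      before (suc i₀) refl _ i<n j∼ = by-cases (S i) refl
        where
        by-cases : ∀ s → S i ≡ s → Goal
        by-cases false eq = inj₁ (trans j∼ (e-same i<n eq))
        by-cases true  eq =
          let t , o , x∼t = Linked-open e (mode i) (S i) (stk i) (separated i<n) eq (proj₁ (linked i (<⇒≤ i<n)))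
          in via-open (t , o , trans j∼ x∼t)

    constant : ∀ {j} → j < n → e j ≡ e m
    constant j<n with covered n ≤-refl j<n
    ... | inj₁ j∼m         = j∼m
    ... | inj₂ (_ , o , _) = contradiction o no-open-at-end

  meander : ShallowTopMeander n
  meander = (π , ρ) , Convex⇒IsInterval π (λ a<b b<c c<n → π-Convex a<b b<c c<n) ,
    distance-intro π ρ ranks λ e resp-π resp-ρ a<n b<n →
      trans (constant e (λ x<n y<n → resp-π x<n y<n) (λ x<n y<n → resp-ρ x<n y<n) a<n)
        (sym (constant e (λ x<n y<n → resp-π x<n y<n) (λ x<n y<n → resp-ρ x<n y<n) b<n))

-- Encoding a meander

connects-intro : ∀ m f stk → (f ≡ false → ∃[ t ] Open t stk) → (f ≡ false → m ≡ floating) → connects m f stk ≡ true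
connects-intro attached true  stk     _        _      = refl
connects-intro floating true  stk     _        _      = refl
connects-intro attached false stk     _        float  = case float refl of λ ()
connects-intro floating false []      nonEmpty _      = case nonEmpty refl of λ ()
connects-intro floating false (_ ∷ _) _        _      = refl

empty : ∀ stk → (∀ {t} → ¬ Open t stk) → stk ≡ []
empty []            none = refl
empty ((t , _) ∷ _) none = contradiction (here refl) (none {t})

-- Attaches a property to floating modes alone. For a mode on the stack the position is that at
-- which its block was opened, so the property is available again when the block closes and the mode
-- is restored.
Recorded : Mode → (ℕ → Set) → ℕ → Set
Recorded floating P i = P i
Recorded attached P i = ⊤

AllRecorded : (ℕ → Set) → Stack → Set
AllRecorded P []              = ⊤
AllRecorded P ((t , k) ∷ stk) = Recorded k P t × AllRecorded P stk

Recorded-move : ∀ (P Q : ℕ → Set) i m f l stk → Recorded m P i → AllRecorded P stk → (f ≡ false → ∃[ t ] Open t stk) →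
  (l ≡ true → P (label i f stk) → Q (suc i)) →
  let k , stk′ = move i m f l stk in Recorded k Q (suc i) × AllRecorded P stk′
Recorded-move P Q i attached true  true  stk             r all        _        extend = tt , all
Recorded-move P Q i floating true  true  stk             r all        _        extend = extend refl r , all
Recorded-move P Q i m        true  false stk             r all        _        extend = tt , r , all
Recorded-move P Q i m        false l     []              r all        nonEmpty extend = case nonEmpty refl of λ ()
Recorded-move P Q i m        false false (x ∷ stk)       r all        _        extend = tt , all
Recorded-move P Q i m        false true  ((t , attached) ∷ stk) r (_ , all) _  extend = tt , all
Recorded-move P Q i m        false true  ((t , floating) ∷ stk) r (p , all) _  extend = extend refl p , all

module Encode {m : ℕ} (π ρ : NC (suc m)) (convex : Convex π)
  (shortest : ∀ l → Walk l π ρ → m ≤ l) where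

  open Run (letterOf π ρ)

  private
    n = suc m
    nc : NonCrossingOn n (cls ρ)
    nc = cls-nonCrossing ρ

  Active : ℕ → ℕ → Set
  Active i t = t < i × First (cls ρ) t × (∃[ k ] i ≤ k × k < n × cls ρ k ≡ cls ρ t)

  ActiveIsOpen : ℕ → Set
  ActiveIsOpen i = (∀ {t} → Open t (stk i) → Active i t) × (∀ {t} → Active i t → Open t (stk i))

  F-true : ∀ i → F i ≡ true → First (cls ρ) i
  F-true i = does-true⁻¹ (clsFirst? ρ i)

  earlier : ∀ i → F i ≡ false → ∃[ t ] t < i × First (cls ρ) t × cls ρ t ≡ cls ρ i
  earlier i eq with firstOf _≟ˢ_ (cls ρ) i
  ... | t , t≤i , first , t∼i with m≤n⇒m<n∨m≡n t≤i
  ...   | inj₁ t<i  = t , t<i , first , t∼i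
  ...   | inj₂ refl = contradiction first (does-false⁻¹ (clsFirst? ρ t) eq)

  hasOpen′ : ∀ {i} → i < n → ActiveIsOpen i → HasOpen i
  hasOpen′ {i} i<n (_ , active) eq = let t , t<i , first , t∼i = earlier i eq in
    t , active (t<i , first , i , ≤-refl , i<n , sym t∼i)

  -- The last open block must be the block of i: the minimum of the block of i is active, hence open
  -- and not above the top. If it were strictly below, the block of i and the last open block, which
  -- still has a point from i on, would cross or coincide.
  lab-spec : ∀ {i} → i < n → ActiveIsOpen i → First (cls ρ) (lab i) × cls ρ (lab i) ≡ cls ρ i
  lab-spec {i} i<n inv@(open⇒ , ⇒open) = by-cases (F i) refl
    where
    by-cases : ∀ f → F i ≡ f → First (cls ρ) (lab i) × cls ρ (lab i) ≡ cls ρ i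
    by-cases true  eq rewrite lab-first i eq = F-true i eq , refl
    by-cases false eq = from-top (earlier i eq) (open⇒ (lab-open i (hasOpen′ i<n inv) eq))
      where
      from-top : ∃[ t ] t < i × First (cls ρ) t × cls ρ t ≡ cls ρ i → Active i (lab i) →
                 First (cls ρ) (lab i) × cls ρ (lab i) ≡ cls ρ i
      from-top (t , t<i , first , t∼i) (top<i , first-top , k , i≤k , k<n , k∼top)
        with m≤n⇒m<n∨m≡n (lab-max i eq (⇒open (t<i , first , i , ≤-refl , i<n , sym t∼i))) | m≤n⇒m<n∨m≡n i≤k
      ... | inj₂ t≡top | _         = first-top , trans (cong (cls ρ) (sym t≡top)) t∼i
      ... | inj₁ _     | inj₂ refl = first-top , sym k∼top
      ... | inj₁ t<top | inj₁ i<k  = first-top , trans (sym (nc t<top top<i i<k k<n t∼i (sym k∼top))) t∼i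

  E-false : ∀ i → E i ≡ false → ∃[ k ] i < k × k < n × cls ρ k ≡ cls ρ i
  E-false i eq with lastOf _≟ˢ_ n (cls ρ) i
  ... | find with i <? n
  ...   | no i≮n = contradiction (λ b b<n i<b _ → i≮n (<-trans i<b b<n)) (does-false⁻¹ (clsLast? ρ i) eq)
  ...   | yes i<n with find i<n
  ...     | k , i≤k , k<n , last , k∼i with m≤n⇒m<n∨m≡n i≤k
  ...       | inj₁ i<k  = k , i<k , k<n , k∼i
  ...       | inj₂ refl = contradiction last (does-false⁻¹ (clsLast? ρ i) eq)

  not-last : ∀ {i k} → i < k → k < n → cls ρ k ≡ cls ρ i → E i ≡ false
  not-last {i} {k} i<k k<n k∼i = dec-false (clsLast? ρ i) λ last → last k k<n i<k k∼i

  still-open⇒later : ∀ {i t} → i < n → First (cls ρ) t → cls ρ t ≡ cls ρ i → lab i ≡ t → Open t (stk (suc i)) →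
                     ∃[ k ] suc i ≤ k × k < n × cls ρ k ≡ cls ρ t
  still-open⇒later {i} {t} i<n first t∼i lab≡t o =
    let k , i<k , k<n , k∼i = E-false i (¬true λ last → closes i last (subst (λ x → Open x (stk (suc i))) (sym lab≡t) o))
    in k , i<k , k<n , trans k∼i (sym t∼i)

  activeIsOpen : ∀ i → i ≤ n → ActiveIsOpen i
  activeIsOpen zero    _   = (λ ()) , λ ()
  activeIsOpen (suc i) i<n = open⇒ , ⇒open
    where
    inv = activeIsOpen i (<⇒≤ i<n)
    open⇒ : ∀ {t} → Open t (stk (suc i)) → Active (suc i) t
    open⇒ {t} o with Open-suc⁻ i o
    ... | inj₁ (refl , first) = ≤-refl , F-true i first , still-open⇒later i<n (F-true i first) refl (lab-first i first) o
    ... | inj₂ o′ with proj₁ inv o′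
    ...   | t<i , first , k , i≤k , k<n , k∼t with m≤n⇒m<n∨m≡n i≤k
    ...     | inj₁ i<k  = m≤n⇒m≤1+n t<i , first , k , i<k , k<n , k∼t
    ...     | inj₂ refl = m≤n⇒m≤1+n t<i , first ,
      still-open⇒later i<n first (sym k∼t) (First-injective (proj₁ spec) first (trans (proj₂ spec) k∼t)) o
      where spec = lab-spec i<n inv
    ⇒open : ∀ {t} → Active (suc i) t → Open t (stk (suc i))
    ⇒open {t} (t<1+i , first , k , i<k , k<n , k∼t) with m≤n⇒m<n∨m≡n t<1+i
    ... | inj₂ refl = subst (λ x → Open x (stk (suc i))) (lab-first i (dec-true (clsFirst? ρ i) first))
      (stays i (hasOpen′ i<n inv) (not-last i<k k<n k∼t))
    ... | inj₁ t<i with Open-suc i (proj₂ inv (s≤s⁻¹ t<i , first , k , <⇒≤ i<k , k<n , k∼t))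
    ...   | inj₁ o    = o
    ...   | inj₂ refl = stays i (hasOpen′ i<n inv) (not-last i<k k<n (trans k∼t (proj₂ (lab-spec i<n inv))))

  hasOpen : ∀ {i} → i < n → HasOpen i
  hasOpen i<n = hasOpen′ i<n (activeIsOpen _ (<⇒≤ i<n))

  lab-First : ∀ {i} → i < n → First (cls ρ) (lab i)
  lab-First i<n = proj₁ (lab-spec i<n (activeIsOpen _ (<⇒≤ i<n)))

  lab-cls : ∀ {i} → i < n → cls ρ (lab i) ≡ cls ρ i
  lab-cls i<n = proj₂ (lab-spec i<n (activeIsOpen _ (<⇒≤ i<n)))

  lab-≤ : ∀ {i} → i < n → lab i ≤ i
  lab-≤ {i} i<n = ≮⇒≥ λ i<lab → lab-First i<n i i<lab (sym (lab-cls i<n))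

  no-open-at-end : ∀ {t} → ¬ Open t (stk n)
  no-open-at-end o = let _ , _ , k , n≤k , k<n , _ = proj₁ (activeIsOpen n ≤-refl) o in <⇒≱ k<n n≤k

  data Boundary : ℕ → Set where
    left-end : Boundary 0
    between  : ∀ {i} → cls π i ≢ cls π (suc i) → Boundary (suc i)

  Boundary-separates : ∀ {p} → Boundary p → ∀ {a b} → a < p → p ≤ b → b < n → cls π a ≢ cls π b
  Boundary-separates (between {i} differ) {a} {b} a≤i i<b b<n a∼b with m≤n⇒m<n∨m≡n i<b
  ... | inj₂ refl = differ (Convex-step π convex (s≤s⁻¹ a≤i) b<n a∼b)
  ... | inj₁ 1+i<b = differ (Convex-step π convex (s≤s⁻¹ a≤i) (<-trans 1+i<b b<n)
      (convex a≤i 1+i<b b<n a∼b))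

  Boundaries⇒Saturated : ∀ {p q} → Boundary p → Boundary q → Saturated π p q
  Boundaries⇒Saturated {p} {q} bp bq {a} {b} a<n b<n a∼b wa =
    let p≤a , a<q = window-true⁻¹ p q a wa in
    window-true p q b (≮⇒≥ λ b<p → Boundary-separates bp b<p p≤a a<n (sym a∼b))
      (≰⇒> λ q≤b → Boundary-separates bq a<q q≤b b<n a∼b)

  -- The component of a floating interval, up to q, is an interval [p , q).
  Detached : ℕ → ℕ → Set
  Detached p q = Boundary p × Saturated ρ p q

  DetachedBefore : ℕ → Set
  DetachedBefore q = ∃[ p ] p ≤ q × Detached p q

  DetachedBefore⁺ : ℕ → Set
  DetachedBefore⁺ q = ∃[ p ] p < q × Detached p q

  -- The hull [t , i] of a complete block is saturated: by `meets-both-sides` a block leaving it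
  -- would be that very block. Two adjacent saturated windows are then joined.
  Saturated-close : ∀ {i p t} → i < n → First (cls ρ) t → cls ρ t ≡ cls ρ i → t ≤ i → Last n (cls ρ) i → p ≤ t →
                    Saturated ρ p t → Saturated ρ p (suc i)
  Saturated-close {i} {p} {t} i<n first t∼i t≤i last p≤t sat {a} {b} a<n b<n a∼b wa with a <? t
  ... | yes a<t = let p≤a , _ = window-true⁻¹ p (suc i) a wa
                      p≤b , b<t = window-true⁻¹ p t b (sat a<n b<n a∼b (window-true p t a p≤a a<t))
                  in window-true p (suc i) b p≤b (m≤n⇒m≤1+n (<-≤-trans b<t t≤i))
  ... | no a≮t = window-true p (suc i) b (≤-trans p≤t t≤b) (s≤s b≤i)
    where
    a≤i = s≤s⁻¹ (proj₂ (window-true⁻¹ p (suc i) a wa))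
    same : b < t ⊎ i < b → cls ρ a ≡ cls ρ t
    same out = meets-both-sides nc t∼i (≮⇒≥ a≮t) a≤i i<n b<n out a∼b
    t≤b : t ≤ b
    t≤b = ≮⇒≥ λ b<t → first b b<t (trans (sym a∼b) (same (inj₁ b<t)))
    b≤i : b ≤ i
    b≤i = ≮⇒≥ λ i<b → last b b<n i<b (trans (sym a∼b) (trans (same (inj₂ i<b)) t∼i))

  -- After a point has been read the detached window is nonempty, as a two-block partition requires.
  -- At position 0 the mode is floating but there is no such window yet.
  Invariant : ℕ → Set
  Invariant zero    = ⊤
  Invariant (suc i) = Recorded (mode (suc i)) DetachedBefore⁺ (suc i)

  Saturated-empty : ∀ i → Saturated ρ i i
  Saturated-empty i {a} {b} _ _ _ wa = let i≤a , a<i = window-true⁻¹ i i a wa in contradiction i≤a (<⇒≱ a<i)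

  separated-step : ∀ i → i < n → Invariant i → separates (mode i) (S i) ≡ true
  separated-step zero    _   _   = refl
  separated-step (suc i) i<n inv = by-cases (mode (suc i)) (S (suc i)) refl inv
    where
    by-cases : ∀ k s → S (suc i) ≡ s → Recorded k DetachedBefore⁺ (suc i) → separates k s ≡ true
    by-cases attached s     eq _ = refl
    by-cases floating false eq _ = refl
    -- A new interval at `suc i` puts a boundary of π at the right end too, so the window is
    -- saturated for both partitions.
    by-cases floating true  eq (p , p<q , boundary , sat) = ⊥-elim (no-saturated-window π ρ shortest p (suc i) p<q i<n
      (Boundaries⇒Saturated boundary (between (startBit-true π i eq))) (λ a<n b<n → sat a<n b<n))

  joined-recorded : ∀ i → i < n → Invariant i → Recorded (joined i) DetachedBefore i
  joined-recorded zero    _   _   = 0 , z≤n , left-end , λ {a} {b} → Saturated-empty 0 {a} {b}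
  joined-recorded (suc i) i<n inv = by-cases (mode (suc i)) (S (suc i)) refl (separated-step (suc i) i<n inv) inv
    where
    by-cases : ∀ k s → S (suc i) ≡ s → separates k s ≡ true → Recorded k DetachedBefore⁺ (suc i) →
               Recorded (join k s) DetachedBefore (suc i)
    by-cases attached false eq _ _ = tt
    by-cases attached true  eq _ _ = suc i , ≤-refl , between (startBit-true π i eq) , λ {a} {b} → Saturated-empty (suc i) {a} {b}
    by-cases floating false eq _ (p , p<q , detached) = p , <⇒≤ p<q , detached

  recorded : ∀ i → i ≤ n → Invariant i × AllRecorded DetachedBefore (stk i)
  recorded zero    _   = tt , tt
  recorded (suc i) i<n = Recorded-move DetachedBefore DetachedBefore⁺ i (joined i) (F i) (E i) (stk i)
    (joined-recorded i i<n (proj₁ (recorded i (<⇒≤ i<n)))) (proj₂ (recorded i (<⇒≤ i<n))) (hasOpen i<n)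
    λ last (p , p≤t , boundary , sat) → p , s≤s (≤-trans p≤t (lab-≤ i<n)) , boundary ,
      Saturated-close i<n (lab-First i<n) (lab-cls i<n) (lab-≤ i<n) (does-true⁻¹ (clsLast? ρ i) last) p≤t
        (λ a<n b<n → sat a<n b<n)

  separated : ∀ {i} → i < n → separates (mode i) (S i) ≡ true
  separated {i} i<n = separated-step i i<n (proj₁ (recorded i (<⇒≤ i<n)))

  -- Euler's formula combined with the walk through `one`. Since no block is open at the end, the
  -- weight there is at most 1; this forces the floating mode and leaves no room for a cycle.
  cycles-bound : suc n + cnt cyc n ≤ n + weight (run (letterOf π ρ) n)
  cycles-bound = begin
    suc n + cnt cyc n                       ≤⟨ +-monoˡ-≤ (cnt cyc n) (ranks-≥ π ρ shortest) ⟩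
    rank π + rank ρ + cnt cyc n             ≡⟨ cong (λ r → r + rank ρ + cnt cyc n) (rank-starts π convex) ⟩
    suc (cnt S n + cnt F n + cnt cyc n)     ≡⟨ weight-run n separated hasOpen ⟩
    n + weight (run (letterOf π ρ) n)       ∎
    where open ≤-Reasoning

  end : ∀ σ → proj₂ σ ≡ [] → suc n + cnt cyc n ≤ n + weight σ → σ ≡ (floating , []) × cnt cyc n ≡ 0
  end (attached , .[]) refl bound = contradiction
    (≤-trans (m≤m+n (suc n) (cnt cyc n)) (≤-trans bound (≤-reflexive (+-identityʳ n)))) 1+n≰n
  end (floating , .[]) refl bound = refl ,
    n≤0⇒n≡0 (+-cancelˡ-≤ (suc n) _ _ (≤-trans bound (≤-reflexive (trans (+-comm n 1) (sym (+-identityʳ (suc n)))))))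

  final : run (letterOf π ρ) n ≡ (floating , []) × cnt cyc n ≡ 0
  final = end (run (letterOf π ρ) n) (empty (stk n) no-open-at-end) cycles-bound

  legal-all : ∀ {i} → i < n → legal (letterOf π ρ i) (run (letterOf π ρ) i) ≡ true
  legal-all {i} i<n = cong₂ _∧_ (separated i<n)
    (connects-intro (joined i) (F i) (stk i) (hasOpen i<n)
      λ eq → cyc-false i eq (cnt-zero⁻¹ n (proj₂ final) i<n))

  accepted : accepts 0 (floating , []) (word (letterOf π ρ) 0 n) ≡ true
  accepted = accepts-intro (letterOf π ρ) 0 n (λ _ i<n → legal-all i<n) (proj₁ final)

  cls⇔lab : ∀ {a b} → a < n → b < n → cls ρ a ≡ cls ρ b ⇔ lab a ≡ lab b
  cls⇔lab a<n b<n = mk⇔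
    (λ a∼b → First-injective (lab-First a<n) (lab-First b<n) (trans (lab-cls a<n) (trans a∼b (sym (lab-cls b<n)))))
    (λ eq → trans (sym (lab-cls a<n)) (trans (cong (cls ρ) eq) (lab-cls b<n)))

-- The bijection with accepted words

-- A section of an injective map is a two-sided inverse, so the meander decoded from an encoded one
-- is never compared with the original directly.
injection⇒cardinality : ∀ (S : Setoid 0ℓ 0ℓ) {A : Set} {k} → let open Setoid S renaming (_≈_ to _≈ˢ_) in
  (f : Carrier → A) → (∀ x y → x ≈ˢ y → f x ≡ f y) → (∀ x y → f x ≡ f y → x ≈ˢ y) →
  (g : A → Carrier) → (∀ a → f (g a) ≡ a) → A ↔ Fin k → HasCardinality S k
injection⇒cardinality S f f-cong f-injective g f∘g code = record
  { to        = to ∘ f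
  ; from      = g ∘ from
  ; to-cong   = λ {x} {y} x≈y → cong to (f-cong x y x≈y)
  ; from-cong = λ { refl → Setoid.refl S }
  ; inverse   =
      (λ {i} {x} x≈ → trans (cong to (trans (f-cong x (g (from i)) x≈) (f∘g (from i)))) (strictlyInverseˡ i)) ,
      (λ { {x} refl → f-injective (g (from (to (f x)))) x (trans (f∘g _) (strictlyInverseʳ (f x))) })
  }
  where open Inverse code

run-cong : ∀ {g h} i → (∀ {j} → j < i → g j ≡ h j) → run g i ≡ run h i
run-cong zero    g≡h = refl
run-cong (suc i) g≡h = cong₂ (next i) (g≡h ≤-refl) (run-cong i (g≡h ∘ m≤n⇒m≤1+n))

lab-cong : ∀ {g h} i → (∀ {j} → j ≤ i → g j ≡ h j) → Run.lab g i ≡ Run.lab h i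
lab-cong i g≡h = cong₂ (label i) (cong (proj₁ ∘ proj₂) (g≡h ≤-refl)) (cong proj₂ (run-cong i (g≡h ∘ <⇒≤)))

module _ {m : ℕ} where

  private
    n = suc m

  starts⇒⊑ : ∀ (π π′ : NC n) → Convex π → (∀ {i} → i < n → startBit π i ≡ startBit π′ i) → π ⊑ π′
  starts⇒⊑ π π′ convex same {a} {b} a<n b<n a∼b = [ (λ a≤b → up b a≤b b<n a∼b) , (λ b≤a → sym (up a b≤a a<n (sym a∼b))) ]′ (≤-total a b)
    where
    up : ∀ {a} b → a ≤ b → b < n → cls π a ≡ cls π b → cls π′ a ≡ cls π′ b
    up {a} b a≤b b<n a∼b with m≤n⇒m<n∨m≡n a≤b
    ... | inj₂ refl = refl
    up {a} (suc b) a≤b b<n a∼b | inj₁ a<b = trans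
      (up b (s≤s⁻¹ a<b) (<-trans ≤-refl b<n) (trans a∼b (sym step)))
      (startBit-false π′ b (trans (sym (same b<n)) (startBit-≡ π b step)))
      where step = Convex-step π convex (s≤s⁻¹ a<b) b<n a∼b

  open Setoid (M̄₁ n) using () renaming (_≈_ to _≈ᴹ_)

  toWord : ShallowTopMeander n → Satisfying {n} (accepts 0 (floating , []))
  toWord ((π , ρ) , interval , _ , shortest) =
    word (letterOf π ρ) 0 n ,
    Encode.accepted π ρ (λ a<b b<c c<n → IsInterval⇒Convex π interval a<b b<c c<n) shortest

  -- The start bits determine an interval partition. The run, and with it the label of every point,
  -- depends only on the letters, and equal labels mean equal blocks of ρ.
  toWord-injective : ∀ x y → toWord x ≡ toWord y → x ≈ᴹ y
  toWord-injective ((π , ρ) , interval , _ , shortest) ((π′ , ρ′) , interval′ , _ , shortest′) eq =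
    ⊑-antisym π π′
      (starts⇒⊑ π π′ (λ p q r → convex p q r) (λ i<n → cong proj₁ (same i<n)))
      (starts⇒⊑ π′ π (λ p q r → convex′ p q r) (λ i<n → cong proj₁ (sym (same i<n)))) ,
    ⊑-antisym ρ ρ′
      (λ a<n b<n a∼b → Equivalence.from (X′.cls⇔lab a<n b<n)
        (trans (sym (same-lab a<n)) (trans (Equivalence.to (X.cls⇔lab a<n b<n) a∼b) (same-lab b<n))))
      (λ a<n b<n a∼b → Equivalence.from (X.cls⇔lab a<n b<n)
        (trans (same-lab a<n) (trans (Equivalence.to (X′.cls⇔lab a<n b<n) a∼b) (sym (same-lab b<n)))))
    where
    convex : Convex π
    convex = IsInterval⇒Convex π interval
    convex′ : Convex π′
    convex′ = IsInterval⇒Convex π′ interval′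
    module X = Encode π ρ (λ p q r → convex p q r) shortest
    module X′ = Encode π′ ρ′ (λ p q r → convex′ p q r) shortest′
    same : ∀ {i} → i < n → letterOf π ρ i ≡ letterOf π′ ρ′ i
    same i<n = word-injective 0 n (cong proj₁ eq) z≤n i<n
    same-lab : ∀ {i} → i < n → Run.lab (letterOf π ρ) i ≡ Run.lab (letterOf π′ ρ′) i
    same-lab {i} i<n = lab-cong i λ j≤i → same (≤-<-trans j≤i i<n)

  toWord-cong : ∀ x y → x ≈ᴹ y → toWord x ≡ toWord y
  toWord-cong ((π , ρ) , _) ((π′ , ρ′) , _) (π≈π′ , ρ≈ρ′) =
    Satisfying-≡ (word-cong 0 n λ {i} _ _ → cong₂ _,_ (start i) (cong₂ _,_
      (does-⇔ (mk⇔ (λ f b b<i eq → f b b<i (trans (ρ≈ρ′ _) (trans eq (sym (ρ≈ρ′ _)))))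
                    (λ f b b<i eq → f b b<i (trans (sym (ρ≈ρ′ _)) (trans eq (ρ≈ρ′ _)))))
        (clsFirst? ρ i) (clsFirst? ρ′ i))
      (does-⇔ (mk⇔ (λ f b b<n i<b eq → f b b<n i<b (trans (ρ≈ρ′ _) (trans eq (sym (ρ≈ρ′ _)))))
                    (λ f b b<n i<b eq → f b b<n i<b (trans (sym (ρ≈ρ′ _)) (trans eq (ρ≈ρ′ _)))))
        (clsLast? ρ i) (clsLast? ρ′ i))))
    where
    start : ∀ i → startBit π i ≡ startBit π′ i
    start zero    = refl
    start (suc i) = cong₂ (λ V W → not (does (V ≟ˢ W))) (π≈π′ _) (π≈π′ _)

  module _ (w : Vec Letter n) (acc : accepts 0 (floating , []) w ≡ true) where

    private
      w≡ : word (letters w) 0 n ≡ w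
      w≡ = word-letters (letters w) 0 w (λ j → cong (letters w) (+-identityʳ j))
      run-facts = accepts-elim (letters w) 0 n (trans (cong (accepts 0 (floating , [])) w≡) acc)
      module D = Decode {m} (letters w) (proj₁ run-facts z≤n) (proj₂ run-facts)

    fromWord : ShallowTopMeander n
    fromWord = D.meander

    toWord-fromWord : toWord fromWord ≡ (w , acc)
    toWord-fromWord = Satisfying-≡ (trans (word-cong 0 n λ _ i<n → D.letterOf-decode i<n) w≡)

  M̄₁-cardinality : HasCardinality (M̄₁ n) (card {n} (accepts 0 (floating , [])))
  M̄₁-cardinality = injection⇒cardinality (M̄₁ n) toWord toWord-cong toWord-injective
    (λ (w , acc) → fromWord w acc) (λ (w , acc) → toWord-fromWord w acc)
    (Satisfying↔Fin {n} (accepts 0 (floating , [])))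

corollary5p5 : Σ[ a ∈ (ℕ → ℕ) ]
    ((n : ℕ) .{{_ : NonZero n}} → HasCardinality (M̄₁ n) (a n)) ×
    (∣ growthRate a - (+ 522 / 100) ∣< (+ 5 / 1000))
corollary5p5 =
  (λ n → card {n} (accepts 0 (floating , []))) ,
  (λ { (suc m) → M̄₁-cardinality {m} }) ,
  -- The value of the initial state is 1 + F. For words of positive length the term 1 contributes
  -- `L (suc k) 0`, which is zero, and only `L (suc k) 1` remains.
  growthRate-L (λ n → card {n} (accepts 0 (floating , []))) (λ k → card-accepts (suc k) 0 floating [])
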